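{- Let $m,n$ be positive integers with $\gcd(m,n)=1$ and $d=m+n$. Let $v_0=(0,\ldots,0)\in\mathbb R^d$ and, for $i=1,\ldots,d$, $v_i={\bf e}_i+{\bf e}_{i+1}+\cdots+{\bf e}_{i+m-1}$, with indices of the standard unit vectors taken modulo $d$ (${\bf e}_{d+j}={\bf e}_j$). Let $\mathcal P=\mathrm{conv}\{v_0,v_1,\ldots,v_d\}$ and $\delta(\mathcal P)=(\delta_0,\ldots,\delta_d)$ its $\delta$-vector. Then for each $1\le i\le d$, the residue class of $im$ in $\mathbb Z/d\mathbb Z$ lies in $\{\overline1,\overline2,\ldots,\overline{m-1}\}$ if and only if $\delta_i=1$. Moreover, $\delta(\mathcal P)$ is shifted symmetric, i.e. $\delta_{i+1}=\delta_{d-i}$ for each $0\le i\le\lfloor(d-1)/2\rfloor$.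
   Context: For an integral convex polytope $\mathcal P\subset\mathbb R^N$ of dimension $d$, let $i(\mathcal P,n)=|n\mathcal P\cap\mathbb Z^N|$. The $\delta$-vector $\delta(\mathcal P)=(\delta_0,\ldots,\delta_d)$ is defined by $(1-\lambda)^{d+1}\bigl[1+\sum_{n\ge1}i(\mathcal P,n)\lambda^n\bigr]=\sum_{i=0}^d\delta_i\lambda^i$. For an integer $a$, $\overline a$ denotes its class in $\mathbb Z/d\mathbb Z$. -}

module Defs where

open import Data.Nat using (ℕ; zero; suc; _+_; _*_; _∸_; _<ᵇ_; _%_; _≤_)
open import Data.Nat.Combinatorics using (_C_)
open import Data.Bool using (if_then_else_)
open import Data.Fin using (Fin; toℕ)
import Data.Fin as F
open import Data.Vec using (Vec; lookup)
open import Data.Integer as ℤ using (ℤ; +_)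
open import Data.Rational as ℚ using (ℚ; 0ℚ; 1ℚ; _/_)
open import Data.Product using (Σ; _×_; ∃)
open import Function.Definitions using (Injective)
open import Relation.Binary.PropositionalEquality using (_≡_)

sumℚ : ∀ {k} → (Fin k → ℚ) → ℚ
sumℚ {zero}  f = 0ℚ
sumℚ {suc k} f = f F.zero ℚ.+ sumℚ (λ j → f (F.suc j))

sumℤ≤ : ℕ → (ℕ → ℤ) → ℤ
sumℤ≤ zero    f = f 0
sumℤ≤ (suc i) f = sumℤ≤ i f ℤ.+ f (suc i)

-- Vertices of P ⊂ ℝ^d (0-based): vertex 0 is v₀ = 0; vertex (suc j) is v_{j+1},
-- whose coordinate c (0-based, i.e. e_{c+1}) is 1 iff c ≡ j, j+1, …, j+m-1 (mod d),
-- i.e. iff (c + d - j) mod d < m.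
vert : (d m : ℕ) → .{{_ : Data.Nat.NonZero d}} → Fin (suc d) → Fin d → ℚ
vert d m F.zero    c = 0ℚ
vert d m (F.suc j) c =
  if ((toℕ c + d ∸ toℕ j) % d) <ᵇ m then 1ℚ else 0ℚ

InDilate : (d m : ℕ) → .{{_ : Data.Nat.NonZero d}} → ℕ → Vec ℤ d → Set
InDilate d m k x =
  Σ (Fin (suc d) → ℚ) λ μ →
    (∀ j → 0ℚ ℚ.≤ μ j) × (sumℚ μ ≡ 1ℚ) ×
    (∀ c → (lookup x c / 1) ≡ ((+ k) / 1) ℚ.* sumℚ (λ j → μ j ℚ.* vert d m j c))

HasCard : ∀ {d} → (Vec ℤ d → Set) → ℕ → Set
HasCard {d} S c =
  Σ (Fin c → Vec ℤ d) λ f →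
    Injective _≡_ _≡_ f × (∀ a → S (f a)) × (∀ x → S x → ∃ λ a → f a ≡ x)

IsEhrhart : (d m : ℕ) → .{{_ : Data.Nat.NonZero d}} → (ℕ → ℕ) → Set
IsEhrhart d m E = ∀ k → 1 ≤ k → HasCard (InDilate d m k) (E k)

ehr₀ : (ℕ → ℕ) → ℕ → ℤ
ehr₀ E zero    = + 1
ehr₀ E (suc k) = + E (suc k)

-- δ_i = coefficient of λ^i in (1-λ)^{D+1} (1 + Σ_{k≥1} E k λ^k), D = dim P
delta : (D : ℕ) → (ℕ → ℕ) → ℕ → ℤ
delta D E i = sumℤ≤ i (λ k → sgn k ℤ.* (+ (suc D C k)) ℤ.* ehr₀ E (i ∸ k))
  where
  sgn : ℕ → ℤ
  sgn zero          = + 1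
  sgn (suc zero)    = ℤ.- (+ 1)
  sgn (suc (suc k)) = sgn k

{-# OPTIONS --safe #-}

-- Write a point of kP as x = ∑ rⱼ vⱼ with rⱼ ≥ 0 and ∑ rⱼ ≤ k: coordinate c of x is the sum of m
-- cyclically consecutive rⱼ.  If u m = v d + 1, then u consecutive such windows cover the circle v times
-- and one further position, so m rⱼ is an explicit integral combination of the coordinates of x, and its
-- class modulo m does not depend on j.  Hence rⱼ = aⱼ + t / m with natural aⱼ and a common 0 ≤ t < m, i.e.
-- x = (t , … , t) + ∑ aⱼ vⱼ uniquely, and the condition ∑ rⱼ ≤ k reads ⌈ t d / m ⌉ + ∑ aⱼ ≤ k.  The number
-- of a ∈ ℕᵈ with ∑ aⱼ ≤ s has generating function (1 - λ)^-(d+1), so ∑ δᵢ λⁱ = ∑ₜ λ^⌈ t d / m ⌉.  The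
-- exponents are distinct, and 1 ≤ i ≤ d is one of them iff the remainder of i m modulo d lies in [1 , m - 1].

module Submission where

module Differences where

  open import Defs
  open import Data.Nat as ℕ using (ℕ; zero; suc; _∸_)
  open import Data.Nat.Combinatorics using (_C_; k>n⇒nCk≡0; nCk+nC[k+1]≡[n+1]C[k+1])
  import Data.Nat.Properties as ℕ
  open import Data.Integer as ℤ using (ℤ; +_; -_; _+_; _-_; _*_; 0ℤ; 1ℤ)
  import Data.Integer.Properties as ℤ
  open import Data.Integer.Solver using (module +-*-Solver)
  open import Relation.Binary.PropositionalEquality
  open import Function using (_∘_)

  ∇ : (ℕ → ℤ) → ℕ → ℤ
  ∇ f zero    = f 0
  ∇ f (suc i) = f (suc i) - f i

  ∇^ : ℕ → (ℕ → ℤ) → ℕ → ℤ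
  ∇^ zero    f = f
  ∇^ (suc p) f = ∇ (∇^ p f)

  -- Multiplication of a power series by λʰ.
  shift : ℕ → (ℕ → ℤ) → ℕ → ℤ
  shift zero    f i       = f i
  shift (suc h) f zero    = 0ℤ
  shift (suc h) f (suc i) = shift h f i

  ∇-cong : ∀ {f g} → f ≗ g → ∇ f ≗ ∇ g
  ∇-cong f≗g zero    = f≗g 0
  ∇-cong f≗g (suc i) = cong₂ _-_ (f≗g (suc i)) (f≗g i)

  ∇^-cong : ∀ p {f g} → f ≗ g → ∇^ p f ≗ ∇^ p g
  ∇^-cong zero    f≗g = f≗g
  ∇^-cong (suc p) f≗g = ∇-cong (∇^-cong p f≗g)

  ∇^-∇ : ∀ p f → ∇^ (suc p) f ≗ ∇^ p (∇ f)
  ∇^-∇ zero    f i = refl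
  ∇^-∇ (suc p) f i = ∇-cong (∇^-∇ p f) i

  ∇-+ : ∀ f g → ∇ (λ i → f i + g i) ≗ λ i → ∇ f i + ∇ g i
  ∇-+ f g zero    = refl
  ∇-+ f g (suc i) = solve 4 (λ a b c d → (a :+ b) :- (c :+ d) := (a :- c) :+ (b :- d)) refl
    (f (suc i)) (g (suc i)) (f i) (g i)
    where open +-*-Solver

  ∇^-+ : ∀ p f g → ∇^ p (λ i → f i + g i) ≗ λ i → ∇^ p f i + ∇^ p g i
  ∇^-+ zero    f g i = refl
  ∇^-+ (suc p) f g i = trans (∇-cong (∇^-+ p f g) i) (∇-+ (∇^ p f) (∇^ p g) i)

  ∇-shift : ∀ h f → ∇ (shift h f) ≗ shift h (∇ f)
  ∇-shift zero    f zero    = refl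
  ∇-shift zero    f (suc i) = refl
  ∇-shift (suc h) f zero    = refl
  ∇-shift (suc h) f (suc zero) = trans (ℤ.+-identityʳ _) (∇-shift h f zero)
  ∇-shift (suc h) f (suc (suc i)) = ∇-shift h f (suc i)

  shift-cong : ∀ h {f g} → f ≗ g → shift h f ≗ shift h g
  shift-cong zero    f≗g i       = f≗g i
  shift-cong (suc h) f≗g zero    = refl
  shift-cong (suc h) f≗g (suc i) = shift-cong h f≗g i

  ∇^-shift : ∀ p h f → ∇^ p (shift h f) ≗ shift h (∇^ p f)
  ∇^-shift zero    h f i = refl
  ∇^-shift (suc p) h f i = trans (∇-cong (∇^-shift p h f) i) (∇-shift h (∇^ p f) i)

  ∇^-0 : ∀ p → ∇^ p (λ _ → 0ℤ) ≗ λ _ → 0ℤ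
  ∇^-0 zero    i = refl
  ∇^-0 (suc p) i = trans (∇-cong (∇^-0 p) i) (∇0 i)
    where
    ∇0 : ∇ (λ _ → 0ℤ) ≗ λ _ → 0ℤ
    ∇0 zero    = refl
    ∇0 (suc _) = refl

  sumℤ≤-cong : ∀ i {f g} → f ≗ g → sumℤ≤ i f ≡ sumℤ≤ i g
  sumℤ≤-cong zero    f≗g = f≗g 0
  sumℤ≤-cong (suc i) f≗g = cong₂ _+_ (sumℤ≤-cong i f≗g) (f≗g (suc i))

  sumℤ≤-head : ∀ i f → sumℤ≤ (suc i) f ≡ f 0 + sumℤ≤ i (f ∘ suc)
  sumℤ≤-head zero    f = refl
  sumℤ≤-head (suc i) f = trans (cong (_+ f (suc (suc i))) (sumℤ≤-head i f)) (ℤ.+-assoc (f 0) _ _)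

  sumℤ≤-minus : ∀ i f g → sumℤ≤ i (λ k → f k - g k) ≡ sumℤ≤ i f - sumℤ≤ i g
  sumℤ≤-minus zero    f g = refl
  sumℤ≤-minus (suc i) f g = trans (cong (_+ (f (suc i) - g (suc i))) (sumℤ≤-minus i f g))
    (solve 4 (λ a b c d → (a :- b) :+ (c :- d) := (a :+ c) :- (b :+ d)) refl
      (sumℤ≤ i f) (sumℤ≤ i g) (f (suc i)) (g (suc i)))
    where open +-*-Solver

  sumℤ≤-0 : ∀ i → sumℤ≤ i (λ _ → 0ℤ) ≡ 0ℤ
  sumℤ≤-0 zero    = refl
  sumℤ≤-0 (suc i) = trans (ℤ.+-identityʳ _) (sumℤ≤-0 i)

  alternating : ℕ → ℤ
  alternating zero          = 1ℤ
  alternating (suc zero)    = - 1ℤ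
  alternating (suc (suc k)) = alternating k

  alternating-suc : ∀ k → alternating (suc k) ≡ - alternating k
  alternating-suc zero    = refl
  alternating-suc (suc k) rewrite alternating-suc k = sym (ℤ.neg-involutive (alternating k))

  term : ℕ → (ℕ → ℤ) → ℕ → ℕ → ℤ
  term p f i k = alternating k * + (p C k) * f (i ∸ k)

  term-zero : ∀ p f i → term p f i 0 ≡ f i
  term-zero p f i = ℤ.*-identityˡ (f i)

  term-0 : ∀ f i k → term 0 f (suc i) (suc k) ≡ 0ℤ
  term-0 f i k rewrite k>n⇒nCk≡0 {0} {suc k} ℕ.z<s | ℤ.*-zeroʳ (alternating (suc k)) = refl

  term-pascal : ∀ p f i k →
    term (suc p) f (suc i) (suc k) ≡ term p f (suc i) (suc k) - term p f i k
  term-pascal p f i k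
    rewrite sym (nCk+nC[k+1]≡[n+1]C[k+1] p k) | alternating-suc k
          | ℤ.pos-+ (p C k) (p C suc k)
    = solve 4 (λ s a b f → (:- s) :* (a :+ b) :* f := (:- s) :* b :* f :- s :* a :* f) refl
        (alternating k) (+ (p C k)) (+ (p C suc k)) (f (i ∸ k))
    where open +-*-Solver

  -- The coefficients of (1 - λ)ᵖ are the signed binomials, and ∇ is multiplication by 1 - λ.
  binomial-∇^ : ∀ p f i → sumℤ≤ i (λ k → alternating k * + (p C k) * f (i ∸ k)) ≡ ∇^ p f i
  binomial-∇^ zero f zero = term-zero 0 f 0
  binomial-∇^ zero f (suc i) = begin
    sumℤ≤ (suc i) (term 0 f (suc i))                     ≡⟨ sumℤ≤-head i _ ⟩
    term 0 f (suc i) 0 + sumℤ≤ i (term 0 f (suc i) ∘ suc)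
      ≡⟨ cong₂ _+_ (term-zero 0 f (suc i)) (trans (sumℤ≤-cong i (term-0 f i)) (sumℤ≤-0 i)) ⟩
    f (suc i) + 0ℤ                                       ≡⟨ ℤ.+-identityʳ _ ⟩
    f (suc i)                                            ∎
    where open ≡-Reasoning
  binomial-∇^ (suc p) f zero = trans (term-zero (suc p) f 0)
    (trans (sym (term-zero p f 0)) (binomial-∇^ p f 0))
  binomial-∇^ (suc p) f (suc i) = begin
    sumℤ≤ (suc i) (term (suc p) f (suc i))               ≡⟨ sumℤ≤-head i _ ⟩
    term (suc p) f (suc i) 0 + sumℤ≤ i (term (suc p) f (suc i) ∘ suc)
      ≡⟨ cong₂ _+_ (trans (term-zero (suc p) f (suc i)) (sym (term-zero p f (suc i))))
          (trans (sumℤ≤-cong i (term-pascal p f i)) (sumℤ≤-minus i _ _)) ⟩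
    term p f (suc i) 0 + (sumℤ≤ i (term p f (suc i) ∘ suc) - sumℤ≤ i (term p f i))
      ≡⟨ ℤ.+-assoc (term p f (suc i) 0) _ _ ⟨
    term p f (suc i) 0 + sumℤ≤ i (term p f (suc i) ∘ suc) - sumℤ≤ i (term p f i)
      ≡⟨ cong (_- sumℤ≤ i (term p f i)) (sumℤ≤-head i _) ⟨
    sumℤ≤ (suc i) (term p f (suc i)) - sumℤ≤ i (term p f i)
      ≡⟨ cong₂ _-_ (binomial-∇^ p f (suc i)) (binomial-∇^ p f i) ⟩
    ∇^ p f (suc i) - ∇^ p f i                            ∎
    where open ≡-Reasoning

  -- The sign function local to delta cannot be named here.  The two left-hand sides written _ are
  -- inferred, the first from the unfolding of delta, the second once the factors multiplying the
  -- sign have been abstracted.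
  mutual
    delta-alternating : ∀ D E i →
      delta D E i ≡ sumℤ≤ i (λ k → alternating k * + (suc D C k) * ehr₀ E (i ∸ k))
    delta-alternating D E i = sumℤ≤-cong i (summand D E i)

    summand : ∀ D E i k → _ ≡ alternating k * + (suc D C k) * ehr₀ E (i ∸ k)
    summand D E i k with suc D C k | ehr₀ E (i ∸ k)
    ... | c | e = signed D E i k c e

    signed : ∀ (D : ℕ) (E : ℕ → ℕ) (i k c : ℕ) (e : ℤ) → _ ≡ alternating k * + c * e
    signed D E i zero          c e = refl
    signed D E i (suc zero)    c e = refl
    signed D E i (suc (suc k)) c e = signed D E i k c e

  delta-∇^ : ∀ D E i → delta D E i ≡ ∇^ (suc D) (ehr₀ E) i
  delta-∇^ D E i = trans (delta-alternating D E i)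
    (binomial-∇^ (suc D) (ehr₀ E) i)

module BoxHeights where

  open import Data.Nat using (ℕ; zero; suc; _+_; _*_; _∸_; _%_; _/_; _≤_; _<_; s≤s; s≤s⁻¹; >-nonZero)
  open import Data.Nat.Properties
  open import Data.Nat.DivMod
  open import Data.Nat.Divisibility using (divides; ∣⇒≤)
  open import Data.Nat.Coprimality using (Coprime; coprime-divisor)
  open import Data.Nat.Tactic.RingSolver using (solve-∀)
  open import Data.Integer as ℤ using (ℤ; 0ℤ; 1ℤ)
  open import Data.Product using (_×_; _,_; ∃-syntax)
  open import Data.Sum using (inj₁; inj₂)
  open import Relation.Nullary using (contradiction)
  open import Relation.Binary.PropositionalEquality
  open import Relation.Binary.Definitions using (tri<; tri≈; tri>)
  open Differences

  unit : ℕ → ℤ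
  unit zero    = 1ℤ
  unit (suc _) = 0ℤ

  shift-unit-≡ : ∀ h → shift h unit h ≡ 1ℤ
  shift-unit-≡ zero    = refl
  shift-unit-≡ (suc h) = shift-unit-≡ h

  shift-unit-≢ : ∀ {h i} → h ≢ i → shift h unit i ≡ 0ℤ
  shift-unit-≢ {zero}  {zero}  h≢i = contradiction refl h≢i
  shift-unit-≢ {zero}  {suc i} h≢i = refl
  shift-unit-≢ {suc h} {zero}  h≢i = refl
  shift-unit-≢ {suc h} {suc i} h≢i = shift-unit-≢ (λ h≡i → h≢i (cong suc h≡i))

  module _ (h : ℕ → ℕ) where

    fibre : ℕ → ℕ → ℤ
    fibre zero    i = 0ℤ
    fibre (suc b) i = shift (h b) unit i ℤ.+ fibre b i

    fibre-empty : ∀ {i} b → (∀ t → t < b → h t ≢ i) → fibre b i ≡ 0ℤ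
    fibre-empty zero    ∄t = refl
    fibre-empty (suc b) ∄t = cong₂ ℤ._+_ (shift-unit-≢ (∄t b (n<1+n b)))
      (fibre-empty b (λ t t<b → ∄t t (m<n⇒m<1+n t<b)))

    fibre-singleton : (∀ {t u} → h t ≡ h u → t ≡ u) → ∀ {t} b → t < b → fibre b (h t) ≡ 1ℤ
    fibre-singleton inj {t} (suc b) t<1+b with m≤n⇒m<n∨m≡n (s≤s⁻¹ t<1+b)
    ... | inj₁ t<b  = cong₂ ℤ._+_ (shift-unit-≢ (λ e → <⇒≢ t<b (sym (inj e)))) (fibre-singleton inj b t<b)
    ... | inj₂ refl = cong₂ ℤ._+_ (shift-unit-≡ (h b)) (fibre-empty b (λ u u<b e → <⇒≢ u<b (inj e)))

  module Heights (m-1 n : ℕ) where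

    m = suc m-1
    d = m + n

    -- ⌈ t d / m ⌉, the height of the box point (t , … , t).
    height : ℕ → ℕ
    height t = (t * d + m-1) / m

    td≤height*m : ∀ t → t * d ≤ height t * m
    td≤height*m t = +-cancelʳ-≤ m-1 _ _ (begin
      t * d + m-1                             ≡⟨ m≡m%n+[m/n]*n (t * d + m-1) m ⟩
      (t * d + m-1) % m + height t * m        ≤⟨ +-monoˡ-≤ _ (s≤s⁻¹ (m%n<n (t * d + m-1) m)) ⟩
      m-1 + height t * m                      ≡⟨ +-comm m-1 _ ⟩
      height t * m + m-1                      ∎)
      where open ≤-Reasoning

    height*m<td+m : ∀ t → height t * m < t * d + m
    height*m<td+m t = begin-strict
      height t * m   ≤⟨ m/n*n≤m (t * d + m-1) m ⟩
      t * d + m-1    <⟨ n<1+n _ ⟩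
      suc (t * d + m-1) ≡⟨ +-suc (t * d) m-1 ⟨
      t * d + m      ∎
      where open ≤-Reasoning

    height-≤ : ∀ t {i} → t * d ≤ i * m → height t ≤ i
    height-≤ t {i} td≤im = s≤s⁻¹ (*-cancelʳ-< m (height t) (suc i) (begin-strict
      height t * m  <⟨ height*m<td+m t ⟩
      t * d + m     ≤⟨ +-monoˡ-≤ m td≤im ⟩
      i * m + m     ≡⟨ +-comm (i * m) m ⟩
      suc i * m     ∎))
      where open ≤-Reasoning

    height-≥ : ∀ t {i} → i * m < t * d + m → i ≤ height t
    height-≥ t {i} im<td+m = s≤s⁻¹ (*-cancelʳ-< m i (suc (height t)) (begin-strict
      i * m              <⟨ im<td+m ⟩
      t * d + m          ≤⟨ +-monoˡ-≤ m (td≤height*m t) ⟩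
      height t * m + m   ≡⟨ +-comm (height t * m) m ⟩
      suc (height t) * m ∎))
      where open ≤-Reasoning

    height-< : ∀ {t u} → t < u → height t < height u
    height-< {t} {u} t<u = *-cancelʳ-< m _ _ (begin-strict
      height t * m  <⟨ height*m<td+m t ⟩
      t * d + m     ≤⟨ +-monoʳ-≤ (t * d) (m≤m+n m n) ⟩
      t * d + d     ≡⟨ +-comm (t * d) d ⟩
      suc t * d     ≤⟨ *-monoˡ-≤ d t<u ⟩
      u * d         ≤⟨ td≤height*m u ⟩
      height u * m  ∎)
      where open ≤-Reasoning

    height-injective : ∀ {t u} → height t ≡ height u → t ≡ u
    height-injective {t} {u} e with <-cmp t u
    ... | tri< t<u _ _ = contradiction e (<⇒≢ (height-< t<u))
    ... | tri≈ _ t≡u _ = t≡u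
    ... | tri> _ _ t>u = contradiction (sym e) (<⇒≢ (height-< t>u))

    height+-≤⁺ : ∀ t s k → s * m + t * d ≤ k * m → height t + s ≤ k
    height+-≤⁺ t s k le = s≤s⁻¹ (*-cancelʳ-< m (height t + s) (suc k) (begin-strict
      (height t + s) * m     ≡⟨ *-distribʳ-+ m (height t) s ⟩
      height t * m + s * m   <⟨ +-monoˡ-< (s * m) (height*m<td+m t) ⟩
      t * d + m + s * m      ≡⟨ rearrange (t * d) m (s * m) ⟩
      m + (s * m + t * d)    ≤⟨ +-monoʳ-≤ m le ⟩
      suc k * m              ∎))
      where
      open ≤-Reasoning
      rearrange : ∀ a b c → a + b + c ≡ b + (c + a)
      rearrange = solve-∀

    height+-≤⁻ : ∀ t s k → height t + s ≤ k → s * m + t * d ≤ k * m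
    height+-≤⁻ t s k le = begin
      s * m + t * d          ≤⟨ +-monoʳ-≤ (s * m) (td≤height*m t) ⟩
      s * m + height t * m   ≡⟨ +-comm (s * m) _ ⟩
      height t * m + s * m   ≡⟨ *-distribʳ-+ m (height t) s ⟨
      (height t + s) * m     ≤⟨ *-monoˡ-≤ m le ⟩
      k * m                  ∎
      where open ≤-Reasoning

    Good : ℕ → Set
    Good i = 1 ≤ (i * m) % d × (i * m) % d ≤ m ∸ 1

    quotient<m : ∀ {i} → i ≤ d → 1 ≤ (i * m) % d → (i * m) / d < m
    quotient<m {i} i≤d 1≤r = *-cancelʳ-< d _ m (begin-strict
        (i * m) / d * d                  <⟨ m<n+m _ 1≤r ⟩
        (i * m) % d + (i * m) / d * d    ≡⟨ m≡m%n+[m/n]*n (i * m) d ⟨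
        i * m                            ≤⟨ *-monoˡ-≤ m i≤d ⟩
        d * m                            ≡⟨ *-comm d m ⟩
        m * d                            ∎)
        where open ≤-Reasoning

    good⇒height : ∀ {i} → i ≤ d → Good i → ∃[ t ] t < m × height t ≡ i
    good⇒height {i} i≤d (1≤r , r≤m-1) = q , quotient<m i≤d 1≤r ,
      ≤-antisym (height-≤ q q*d≤) (height-≥ q (begin-strict
        i * m         ≡⟨ m≡m%n+[m/n]*n (i * m) d ⟩
        r + q * d     ≡⟨ +-comm r _ ⟩
        q * d + r     <⟨ +-monoʳ-< (q * d) (s≤s r≤m-1) ⟩
        q * d + m     ∎))
      where
      open ≤-Reasoning
      q = (i * m) / d
      r = (i * m) % d
      q*d≤ : q * d ≤ i * m
      q*d≤ = m/n*n≤m (i * m) d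

    height⇒good : Coprime d m → ∀ {i t} → 1 ≤ i → i ≤ d → t < m → height t ≡ i → Good i
    height⇒good cop {i} {t} 1≤i i≤d t<m refl = 1≤ , ≤m-1
      where
      r = i * m ∸ t * d
      im≡ : i * m ≡ r + t * d
      im≡ = sym (m∸n+n≡m (td≤height*m t))
      r<m : r < m
      r<m = +-cancelʳ-< (t * d) r m (begin-strict
        r + t * d   ≡⟨ im≡ ⟨
        i * m       <⟨ height*m<td+m t ⟩
        t * d + m   ≡⟨ +-comm (t * d) m ⟩
        m + t * d   ∎)
        where open ≤-Reasoning
      %≡r : (i * m) % d ≡ r
      %≡r = trans (cong (_% d) im≡) (trans ([m+kn]%n≡m%n r t d)
        (m<n⇒m%n≡m (<-≤-trans r<m (m≤m+n m n))))
      ≤m-1 : (i * m) % d ≤ m ∸ 1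
      ≤m-1 rewrite %≡r = s≤s⁻¹ r<m
      im≢td : i * m ≢ t * d
      im≢td e = <⇒≱ t<m (*-cancelʳ-≤ m t d (begin
          m * d  ≡⟨ *-comm m d ⟩
          d * m  ≤⟨ *-monoˡ-≤ m d≤i ⟩
          i * m  ≡⟨ e ⟩
          t * d  ∎))
        where
        open ≤-Reasoning
        d≤i : d ≤ i
        d≤i = ∣⇒≤ {{>-nonZero 1≤i}} (coprime-divisor cop (divides t (trans (*-comm m i) e)))
      1≤ : 1 ≤ (i * m) % d
      1≤ rewrite %≡r = n≢0⇒n>0 (λ r≡0 → im≢td (trans im≡ (cong (_+ t * d) r≡0)))

    -- If i m = q d + r then (d + 1 - i) m = (m - q) d + (m - r).
    good-symmetric : ∀ {i j} → i + j ≡ suc d → i ≤ d → Good i → Good j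
    good-symmetric {i} {j} i+j≡1+d i≤d (1≤r , r≤m-1) =
      subst (1 ≤_) (sym %≡) (m<n⇒0<n∸m r<m) , subst (_≤ m-1) (sym %≡) (∸-monoʳ-≤ m 1≤r)
      where
      q = (i * m) / d
      r = (i * m) % d
      r<m : r < m
      r<m = s≤s r≤m-1
      q≤m : q ≤ m
      q≤m = <⇒≤ (quotient<m i≤d 1≤r)
      rearrange : ∀ r q d s p → (r + q * d) + (s + p * d) ≡ (r + s) + (q + p) * d
      rearrange = solve-∀
      jm≡ : j * m ≡ (m ∸ r) + (m ∸ q) * d
      jm≡ = +-cancelˡ-≡ (i * m) _ _ (begin
        i * m + j * m                               ≡⟨ *-distribʳ-+ m i j ⟨
        (i + j) * m                                 ≡⟨ cong (_* m) i+j≡1+d ⟩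
        suc d * m                                   ≡⟨ cong (m +_) (*-comm d m) ⟩
        m + m * d
          ≡⟨ cong₂ (λ a b → a + b * d) (m+[n∸m]≡n (<⇒≤ r<m)) (m+[n∸m]≡n q≤m) ⟨
        (r + (m ∸ r)) + (q + (m ∸ q)) * d           ≡⟨ rearrange r q d (m ∸ r) (m ∸ q) ⟨
        (r + q * d) + ((m ∸ r) + (m ∸ q) * d)
          ≡⟨ cong (_+ ((m ∸ r) + (m ∸ q) * d)) (m≡m%n+[m/n]*n (i * m) d) ⟨
        i * m + ((m ∸ r) + (m ∸ q) * d)             ∎)
        where open ≡-Reasoning
      m∸r<d : m ∸ r < d
      m∸r<d = <-≤-trans (∸-monoʳ-< {m} 1≤r (<⇒≤ r<m)) (m≤m+n m n)
      %≡ : (j * m) % d ≡ m ∸ r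
      %≡ = trans (cong (_% d) jm≡) (trans ([m+kn]%n≡m%n (m ∸ r) (m ∸ q) d) (m<n⇒m%n≡m m∸r<d))

module Enumeration where

  open import Defs
  open Differences
  open BoxHeights
  open import Data.Nat as ℕ using (ℕ; zero; suc; _≤_; _<_; s≤s; s≤s⁻¹; z≤n)
  import Data.Nat.Properties as ℕ
  open import Data.Integer as ℤ using (ℤ; +_; _+_; _-_)
  import Data.Integer.Properties as ℤ
  open import Data.Integer.Solver using (module +-*-Solver)
  open import Data.Fin using (Fin; zero; suc)
  open import Data.Fin.Properties using (injective⇒≤)
  open import Data.List using (List; []; _∷_; map; _++_; length; lookup)
  open import Data.List.Properties using (length-map; length-++)
  open import Data.List.Membership.Propositional using (_∈_)
  open import Data.List.Membership.Propositional.Properties using (∈-map⁺; ∈-map⁻; ∈-++⁺ˡ; ∈-++⁺ʳ; ∈-++⁻; ∈-lookup)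
  import Data.List.Membership.Setoid.Properties as Membership
  open import Data.List.Relation.Unary.All as All using ([])
  open import Data.List.Relation.Unary.Any using (here; index)
  open import Data.List.Relation.Unary.AllPairs using ([]; _∷_)
  open import Data.List.Relation.Unary.Unique.Propositional using (Unique)
  open import Data.List.Relation.Unary.Unique.Propositional.Properties using (map⁺; ++⁺)
  open import Data.Vec using (Vec; []; _∷_; sum)
  open import Data.Vec.Properties using (∷-injectiveʳ)
  open import Data.Product using (_×_; _,_; ∃-syntax; proj₁; proj₂)
  open import Data.Product.Properties using (,-injectiveʳ)
  open import Data.Sum using (inj₁; inj₂)
  open import Relation.Nullary using (contradiction)
  open import Relation.Binary.PropositionalEquality

  lookup-injective : ∀ {A : Set} {xs : List A} → Unique xs → ∀ {i j} → lookup xs i ≡ lookup xs j → i ≡ j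
  lookup-injective (x∉ ∷ u) {zero}  {zero}  e = refl
  lookup-injective (x∉ ∷ u) {zero}  {suc j} e = contradiction e (All.lookup x∉ (∈-lookup j))
  lookup-injective (x∉ ∷ u) {suc i} {zero}  e = contradiction (sym e) (All.lookup x∉ (∈-lookup i))
  lookup-injective (x∉ ∷ u) {suc i} {suc j} e = cong suc (lookup-injective u e)

  HasCard-length : ∀ {A : Set} {d c} {S : Vec ℤ d → Set} (xs : List A) (f : A → Vec ℤ d) → Unique xs →
    (∀ {a b} → a ∈ xs → b ∈ xs → f a ≡ f b → a ≡ b) →
    (∀ {a} → a ∈ xs → S (f a)) →
    (∀ v → S v → ∃[ a ] a ∈ xs × f a ≡ v) →
    HasCard S c → c ≡ length xs
  HasCard-length {A} {d} {c} {S} xs f xs! f-inj f-sound f-complete (g , g-inj , g-sound , g-complete) =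
    ℕ.≤-antisym (injective⇒≤ to-inj) (injective⇒≤ from-inj)
    where
    pre : ∀ i → ∃[ a ] a ∈ xs × f a ≡ g i
    pre i = f-complete (g i) (g-sound i)
    to : Fin c → Fin (length xs)
    to i = index (proj₁ (proj₂ (pre i)))
    to-inj : ∀ {i j} → to i ≡ to j → i ≡ j
    to-inj {i} {j} e = let (a , a∈ , fa≡) = pre i; (b , b∈ , fb≡) = pre j in
      g-inj (trans (sym fa≡) (trans (cong f (Membership.index-injective (setoid A) a∈ b∈ e)) fb≡))
    post : ∀ i → ∃[ j ] g j ≡ f (lookup xs i)
    post i = g-complete _ (f-sound (∈-lookup i))
    from : Fin (length xs) → Fin c
    from i = proj₁ (post i)
    from-inj : ∀ {i j} → from i ≡ from j → i ≡ j
    from-inj {i} {j} e = lookup-injective xs! (f-inj (∈-lookup i) (∈-lookup j)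
      (trans (sym (proj₂ (post i))) (trans (cong g e) (proj₂ (post j)))))

  increment : ∀ {d} → Vec ℕ (suc d) → Vec ℕ (suc d)
  increment (x ∷ xs) = suc x ∷ xs

  tuples : ∀ d → ℕ → List (Vec ℕ d)
  tuples zero    s       = [] ∷ []
  tuples (suc d) zero    = map (0 ∷_) (tuples d zero)
  tuples (suc d) (suc s) = map (0 ∷_) (tuples d (suc s)) ++ map increment (tuples (suc d) s)

  ∈-tuples⁺ : ∀ {d s} (a : Vec ℕ d) → sum a ≤ s → a ∈ tuples d s
  ∈-tuples⁺ {s = s}     []           _  = here refl
  ∈-tuples⁺ {s = zero}  (zero  ∷ a)  le = ∈-map⁺ (0 ∷_) (∈-tuples⁺ a le)
  ∈-tuples⁺ {s = suc s} (zero  ∷ a)  le = ∈-++⁺ˡ (∈-map⁺ (0 ∷_) (∈-tuples⁺ a le))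
  ∈-tuples⁺ {suc d} {suc s} (suc x ∷ a) le =
    ∈-++⁺ʳ (map (0 ∷_) (tuples d (suc s))) (∈-map⁺ increment (∈-tuples⁺ (x ∷ a) (s≤s⁻¹ le)))

  ∈-tuples⁻ : ∀ {d s} {a : Vec ℕ d} → a ∈ tuples d s → sum a ≤ s
  ∈-tuples⁻ {zero}  {s} {[]} _ = z≤n
  ∈-tuples⁻ {suc d} {zero} a∈ with ∈-map⁻ (0 ∷_) a∈
  ... | b , b∈ , refl = ∈-tuples⁻ b∈
  ∈-tuples⁻ {suc d} {suc s} a∈ with ∈-++⁻ (map (0 ∷_) (tuples d (suc s))) a∈
  ... | inj₁ a∈ˡ with ∈-map⁻ (0 ∷_) a∈ˡ
  ...   | b , b∈ , refl = ∈-tuples⁻ b∈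
  ∈-tuples⁻ {suc d} {suc s} a∈ | inj₂ a∈ʳ with ∈-map⁻ increment a∈ʳ
  ...   | (x ∷ b) , b∈ , refl = s≤s (∈-tuples⁻ b∈)

  tuples-unique : ∀ d s → Unique (tuples d s)
  tuples-unique zero    s       = [] ∷ []
  tuples-unique (suc d) zero    = map⁺ ∷-injectiveʳ (tuples-unique d zero)
  tuples-unique (suc d) (suc s) = ++⁺ (map⁺ ∷-injectiveʳ (tuples-unique d (suc s)))
    (map⁺ increment-injective (tuples-unique (suc d) s)) disjoint
    where
    increment-injective : ∀ {d} {a b : Vec ℕ (suc d)} → increment a ≡ increment b → a ≡ b
    increment-injective {a = x ∷ a} {y ∷ b} refl = refl
    disjoint : ∀ {a} → a ∈ map (0 ∷_) (tuples d (suc s)) × a ∈ map increment (tuples (suc d) s) → _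
    disjoint (a∈ˡ , a∈ʳ) with ∈-map⁻ (0 ∷_) a∈ˡ | ∈-map⁻ increment a∈ʳ
    ... | b , _ , refl | (x ∷ c) , _ , ()

  ∇-tuples : ∀ d → ∇ (λ s → + length (tuples (suc d) s)) ≗ λ s → + length (tuples d s)
  ∇-tuples d zero    = cong +_ (length-map (0 ∷_) (tuples d zero))
  ∇-tuples d (suc s) = begin
    + length (tuples (suc d) (suc s)) - + length (tuples (suc d) s)
      ≡⟨ cong (λ l → + l - + length (tuples (suc d) s)) (trans
           (length-++ (map (0 ∷_) (tuples d (suc s))))
           (cong₂ ℕ._+_ (length-map (0 ∷_) (tuples d (suc s))) (length-map increment (tuples (suc d) s)))) ⟩
    + (length (tuples d (suc s)) ℕ.+ length (tuples (suc d) s)) - + length (tuples (suc d) s)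
      ≡⟨ cong (_- + length (tuples (suc d) s)) (ℤ.pos-+ (length (tuples d (suc s))) _) ⟩
    + length (tuples d (suc s)) + + length (tuples (suc d) s) - + length (tuples (suc d) s)
      ≡⟨ solve 2 (λ a b → (a :+ b) :- b := a) refl
           (+ length (tuples d (suc s))) (+ length (tuples (suc d) s)) ⟩
    + length (tuples d (suc s)) ∎
    where
    open ≡-Reasoning
    open +-*-Solver using (solve; _:+_; _:-_; _:=_)

  ∇^-tuples : ∀ d → ∇^ (suc d) (λ s → + length (tuples d s)) ≗ unit
  ∇^-tuples zero    zero    = refl
  ∇^-tuples zero    (suc _) = refl
  ∇^-tuples (suc d) i =
    trans (∇^-∇ (suc d) _ i) (trans (∇^-cong (suc d) (∇-tuples d) i) (∇^-tuples d i))

  delayed : ∀ {d} → ℕ → ℕ → List (Vec ℕ d)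
  delayed zero    k       = tuples _ k
  delayed (suc h) zero    = []
  delayed (suc h) (suc k) = delayed h k

  ∈-delayed⁺ : ∀ {d} h {k} {a : Vec ℕ d} → h ℕ.+ sum a ≤ k → a ∈ delayed h k
  ∈-delayed⁺ zero            le = ∈-tuples⁺ _ le
  ∈-delayed⁺ (suc h) {suc k} le = ∈-delayed⁺ h (s≤s⁻¹ le)

  ∈-delayed⁻ : ∀ {d} h {k} {a : Vec ℕ d} → a ∈ delayed h k → h ℕ.+ sum a ≤ k
  ∈-delayed⁻ zero            a∈ = ∈-tuples⁻ a∈
  ∈-delayed⁻ (suc h) {suc k} a∈ = s≤s (∈-delayed⁻ h a∈)

  delayed-unique : ∀ {d} h k → Unique (delayed {d} h k)
  delayed-unique zero    k       = tuples-unique _ k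
  delayed-unique (suc h) zero    = []
  delayed-unique (suc h) (suc k) = delayed-unique h k

  length-delayed : ∀ {d} h → (λ k → + length (delayed {d} h k)) ≗ shift h (λ s → + length (tuples d s))
  length-delayed zero    k       = refl
  length-delayed (suc h) zero    = refl
  length-delayed (suc h) (suc k) = length-delayed h k

  module _ {d : ℕ} (h : ℕ → ℕ) where

    boxed : ℕ → ℕ → List (ℕ × Vec ℕ d)
    boxed zero    k = []
    boxed (suc b) k = map (b ,_) (delayed (h b) k) ++ boxed b k

    ∈-boxed⁺ : ∀ {t b k a} → t < b → h t ℕ.+ sum a ≤ k → (t , a) ∈ boxed b k
    ∈-boxed⁺ {t} {suc b} {k} t<1+b le with ℕ.m≤n⇒m<n∨m≡n (s≤s⁻¹ t<1+b)
    ... | inj₁ t<b  = ∈-++⁺ʳ (map (b ,_) (delayed (h b) k)) (∈-boxed⁺ t<b le)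
    ... | inj₂ refl = ∈-++⁺ˡ (∈-map⁺ (b ,_) (∈-delayed⁺ (h b) le))

    ∈-boxed⁻ : ∀ {t b k a} → (t , a) ∈ boxed b k → t < b × h t ℕ.+ sum a ≤ k
    ∈-boxed⁻ {t} {suc b} {k} ta∈ with ∈-++⁻ (map (b ,_) (delayed (h b) k)) ta∈
    ... | inj₂ ta∈ʳ = let (t<b , le) = ∈-boxed⁻ {b = b} ta∈ʳ in ℕ.m<n⇒m<1+n t<b , le
    ... | inj₁ ta∈ˡ with ∈-map⁻ (b ,_) ta∈ˡ
    ...   | a , a∈ , refl = ℕ.n<1+n b , ∈-delayed⁻ (h b) a∈

    boxed-unique : ∀ b k → Unique (boxed b k)
    boxed-unique zero    k = []
    boxed-unique (suc b) k = ++⁺ (map⁺ ,-injectiveʳ (delayed-unique (h b) k)) (boxed-unique b k) disjoint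
      where
      disjoint : ∀ {p} → p ∈ map (b ,_) (delayed (h b) k) × p ∈ boxed b k → _
      disjoint (p∈ˡ , p∈ʳ) with ∈-map⁻ (b ,_) p∈ˡ
      ... | a , _ , refl = ℕ.<-irrefl refl (proj₁ (∈-boxed⁻ {b = b} p∈ʳ))

    ∇^-boxed : ∀ b → ∇^ (suc d) (λ k → + length (boxed b k)) ≗ fibre h b
    ∇^-boxed zero    i = ∇^-0 (suc d) i
    ∇^-boxed (suc b) i = begin
      ∇^ (suc d) (λ k → + length (boxed (suc b) k)) i      ≡⟨ ∇^-cong (suc d) length-boxed i ⟩
      ∇^ (suc d) (λ k → shift (h b) count k + + length (boxed b k)) i
        ≡⟨ ∇^-+ (suc d) (shift (h b) count) _ i ⟩
      ∇^ (suc d) (shift (h b) count) i + ∇^ (suc d) (λ k → + length (boxed b k)) i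
        ≡⟨ cong₂ _+_ (trans (∇^-shift (suc d) (h b) count i) (shift-cong (h b) (∇^-tuples d) i)) (∇^-boxed b i) ⟩
      shift (h b) unit i + fibre h b i                     ∎
      where
      open ≡-Reasoning
      count : ℕ → ℤ
      count s = + length (tuples d s)
      length-boxed : ∀ k → + length (boxed (suc b) k) ≡ shift (h b) count k + + length (boxed b k)
      length-boxed k
        rewrite length-++ (map (b ,_) (delayed (h b) k)) {boxed b k}
              | length-map (b ,_) (delayed {d} (h b) k)
              | ℤ.pos-+ (length (delayed {d} (h b) k)) (length (boxed b k))
        = cong (_+ + length (boxed b k)) (length-delayed {d} (h b) k)

module RationalSums where

  open import Defs
  open import Data.Nat as ℕ using (ℕ; zero; suc; _<_; NonZero; z<s; s<s)
  import Data.Nat.Properties as ℕ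
  open import Data.Nat.DivMod using (_%_; _/_; m≡m%n+[m/n]*n)
  open import Data.Integer as ℤ using (ℤ; +_)
  import Data.Integer.Properties as ℤ
  open import Data.Fin as Fin using (Fin; toℕ)
  open import Data.Rational using (ℚ; 0ℚ; 1ℚ; _+_; _*_; -_; _-_; _≤_; toℚᵘ)
  import Data.Rational as ℚ
  open import Data.Rational.Properties
  open import Data.Rational.Unnormalised as ℚᵘ using (ℚᵘ; mkℚᵘ; _≃_; *≡*; *≤*)
  import Data.Rational.Unnormalised.Properties as ℚᵘ
  open import Data.Rational.Solver using (module +-*-Solver)
  open import Relation.Binary.PropositionalEquality
  open import Function using (_∘_)

  ι : ℤ → ℚ
  ι z = z ℚ./ 1

  toℚᵘ-ι : ∀ z → toℚᵘ (ι z) ≃ mkℚᵘ z 0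
  toℚᵘ-ι z = toℚᵘ-fromℚᵘ (mkℚᵘ z 0)

  ι-+ : ∀ a b → ι (a ℤ.+ b) ≡ ι a + ι b
  ι-+ a b = toℚᵘ-injective (begin-equality
    toℚᵘ (ι (a ℤ.+ b))             ≃⟨ toℚᵘ-ι (a ℤ.+ b) ⟩
    mkℚᵘ (a ℤ.+ b) 0               ≃⟨ *≡* (cong (ℤ._* + 1) (sym (cong₂ ℤ._+_ (ℤ.*-identityʳ a) (ℤ.*-identityʳ b)))) ⟩
    mkℚᵘ a 0 ℚᵘ.+ mkℚᵘ b 0         ≃⟨ ℚᵘ.+-cong (toℚᵘ-ι a) (toℚᵘ-ι b) ⟨
    toℚᵘ (ι a) ℚᵘ.+ toℚᵘ (ι b)     ≃⟨ toℚᵘ-homo-+ (ι a) (ι b) ⟨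
    toℚᵘ (ι a + ι b)               ∎)
    where open ℚᵘ.≤-Reasoning

  ι-* : ∀ a b → ι (a ℤ.* b) ≡ ι a * ι b
  ι-* a b = toℚᵘ-injective (begin-equality
    toℚᵘ (ι (a ℤ.* b))             ≃⟨ toℚᵘ-ι (a ℤ.* b) ⟩
    mkℚᵘ a 0 ℚᵘ.* mkℚᵘ b 0         ≃⟨ ℚᵘ.*-cong (toℚᵘ-ι a) (toℚᵘ-ι b) ⟨
    toℚᵘ (ι a) ℚᵘ.* toℚᵘ (ι b)     ≃⟨ toℚᵘ-homo-* (ι a) (ι b) ⟨
    toℚᵘ (ι a * ι b)               ∎)
    where open ℚᵘ.≤-Reasoning

  ι-mono-≤ : ∀ {a b} → a ℤ.≤ b → ι a ≤ ι b
  ι-mono-≤ {a} {b} a≤b = toℚᵘ-cancel-≤ (begin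
    toℚᵘ (ι a)   ≃⟨ toℚᵘ-ι a ⟩
    mkℚᵘ a 0     ≤⟨ *≤* (ℤ.*-monoʳ-≤-nonNeg (+ 1) a≤b) ⟩
    mkℚᵘ b 0     ≃⟨ toℚᵘ-ι b ⟨
    toℚᵘ (ι b)   ∎)
    where open ℚᵘ.≤-Reasoning

  ι-cancel-≤ : ∀ {a b} → ι a ≤ ι b → a ℤ.≤ b
  ι-cancel-≤ {a} {b} ιa≤ιb = ℤ.*-cancelʳ-≤-pos a b (+ 1) (ℚᵘ.drop-*≤* (begin
    mkℚᵘ a 0     ≃⟨ toℚᵘ-ι a ⟨
    toℚᵘ (ι a)   ≤⟨ toℚᵘ-mono-≤ ιa≤ιb ⟩
    toℚᵘ (ι b)   ≃⟨ toℚᵘ-ι b ⟩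
    mkℚᵘ b 0     ∎))
    where open ℚᵘ.≤-Reasoning

  ι-injective : ∀ {a b} → ι a ≡ ι b → a ≡ b
  ι-injective e = ℤ.≤-antisym (ι-cancel-≤ (≤-reflexive e)) (ι-cancel-≤ (≤-reflexive (sym e)))

  ι-neg : ∀ a → ι (ℤ.- a) ≡ - ι a
  ι-neg a = begin
    ι (ℤ.- a)                   ≡⟨ solve 2 (λ x y → y := (x :+ y) :- x) refl (ι a) (ι (ℤ.- a)) ⟩
    ι a + ι (ℤ.- a) - ι a       ≡⟨ cong (_- ι a) (ι-+ a (ℤ.- a)) ⟨
    ι (a ℤ.+ ℤ.- a) - ι a       ≡⟨ cong (λ z → ι z - ι a) (ℤ.+-inverseʳ a) ⟩
    0ℚ - ι a                    ≡⟨ +-identityˡ _ ⟩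
    - ι a                       ∎
    where
    open ≡-Reasoning
    open +-*-Solver

  inv : (m : ℕ) .{{_ : NonZero m}} → ℚ
  inv m = + 1 ℚ./ m

  ι*inv : ∀ m .{{_ : NonZero m}} → ι (+ m) * inv m ≡ 1ℚ
  ι*inv m@(suc m-1) = toℚᵘ-injective (begin-equality
    toℚᵘ (ι (+ m) * inv m)             ≃⟨ toℚᵘ-homo-* (ι (+ m)) (inv m) ⟩
    toℚᵘ (ι (+ m)) ℚᵘ.* toℚᵘ (inv m)   ≃⟨ ℚᵘ.*-cong (toℚᵘ-ι (+ m)) (toℚᵘ-fromℚᵘ (mkℚᵘ (+ 1) m-1)) ⟩
    mkℚᵘ (+ m) 0 ℚᵘ.* mkℚᵘ (+ 1) m-1   ≃⟨ *≡* (trans (ℤ.*-identityʳ _) (trans (ℤ.*-identityʳ (+ m))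
      (sym (trans (ℤ.*-identityˡ _) (cong +_ (ℕ.*-identityˡ m)))))) ⟩
    ℚᵘ.1ℚᵘ                             ∎)
    where open ℚᵘ.≤-Reasoning

  ι-nonNeg : ∀ m → ℚ.NonNegative (ι (+ m))
  ι-nonNeg m = normalize-nonNeg m 1

  inv-nonNeg : ∀ m .{{_ : NonZero m}} → ℚ.NonNegative (inv m)
  inv-nonNeg m = normalize-nonNeg 1 m

  inv*ι*-cancel : ∀ m .{{_ : NonZero m}} p → inv m * (ι (+ m) * p) ≡ p
  inv*ι*-cancel m p = begin
    inv m * (ι (+ m) * p)   ≡⟨ solve 3 (λ x y p → x :* (y :* p) := (y :* x) :* p) refl (inv m) (ι (+ m)) p ⟩
    ι (+ m) * inv m * p     ≡⟨ cong (_* p) (ι*inv m) ⟩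
    1ℚ * p                  ≡⟨ *-identityˡ p ⟩
    p                       ∎
    where
    open ≡-Reasoning
    open +-*-Solver

  ι*-cancel-≡ : ∀ m .{{_ : NonZero m}} {p q} → ι (+ m) * p ≡ ι (+ m) * q → p ≡ q
  ι*-cancel-≡ m {p} {q} e =
    trans (sym (inv*ι*-cancel m p)) (trans (cong (inv m *_) e) (inv*ι*-cancel m q))

  ι*-cancel-≤ : ∀ m .{{_ : NonZero m}} {p q} → ι (+ m) * p ≤ ι (+ m) * q → p ≤ q
  ι*-cancel-≤ m {p} {q} le =
    subst₂ _≤_ (inv*ι*-cancel m p) (inv*ι*-cancel m q) (*-monoˡ-≤-nonNeg (inv m) {{inv-nonNeg m}} le)

  ∑ : ℕ → (ℕ → ℚ) → ℚ
  ∑ zero    f = 0ℚ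
  ∑ (suc k) f = f 0 + ∑ k (f ∘ suc)

  ∑ℤ : ℕ → (ℕ → ℤ) → ℤ
  ∑ℤ zero    f = + 0
  ∑ℤ (suc k) f = f 0 ℤ.+ ∑ℤ k (f ∘ suc)

  ι-∑ℤ : ∀ k f → ι (∑ℤ k f) ≡ ∑ k (ι ∘ f)
  ι-∑ℤ zero    f = refl
  ι-∑ℤ (suc k) f = trans (ι-+ (f 0) _) (cong (_+_ (ι (f 0))) (ι-∑ℤ k (f ∘ suc)))

  ∑-cong-< : ∀ k {f g} → (∀ i → i < k → f i ≡ g i) → ∑ k f ≡ ∑ k g
  ∑-cong-< zero    f≗g = refl
  ∑-cong-< (suc k) f≗g = cong₂ _+_ (f≗g 0 z<s) (∑-cong-< k (λ i i<k → f≗g (suc i) (s<s i<k)))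

  ∑-cong : ∀ k {f g} → f ≗ g → ∑ k f ≡ ∑ k g
  ∑-cong k f≗g = ∑-cong-< k (λ i _ → f≗g i)

  ∑-++ : ∀ a b f → ∑ (a ℕ.+ b) f ≡ ∑ a f + ∑ b (λ i → f (a ℕ.+ i))
  ∑-++ zero    b f = sym (+-identityˡ _)
  ∑-++ (suc a) b f = trans (cong (_+_ (f 0)) (∑-++ a b (f ∘ suc))) (sym (+-assoc (f 0) _ _))

  ∑-+ : ∀ k f g → ∑ k (λ i → f i + g i) ≡ ∑ k f + ∑ k g
  ∑-+ zero    f g = refl
  ∑-+ (suc k) f g = trans (cong (_+_ (f 0 + g 0)) (∑-+ k (f ∘ suc) (g ∘ suc)))
    (solve 4 (λ a b c d → (a :+ b) :+ (c :+ d) := (a :+ c) :+ (b :+ d)) refl (f 0) (g 0) _ _)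
    where open +-*-Solver

  ∑-const : ∀ k c → ∑ k (λ _ → c) ≡ ι (+ k) * c
  ∑-const zero    c = sym (*-zeroˡ c)
  ∑-const (suc k) c = begin
    c + ∑ k (λ _ → c)         ≡⟨ cong (_+_ c) (∑-const k c) ⟩
    c + ι (+ k) * c           ≡⟨ cong (_+ ι (+ k) * c) (*-identityˡ c) ⟨
    1ℚ * c + ι (+ k) * c      ≡⟨ *-distribʳ-+ c 1ℚ (ι (+ k)) ⟨
    (ι (+ 1) + ι (+ k)) * c   ≡⟨ cong (_* c) (ι-+ (+ 1) (+ k)) ⟨
    ι (+ suc k) * c           ∎
    where open ≡-Reasoning

  ∑-*ˡ : ∀ k c f → ∑ k (λ i → c * f i) ≡ c * ∑ k f
  ∑-*ˡ zero    c f = sym (*-zeroʳ c)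
  ∑-*ˡ (suc k) c f = trans (cong (_+_ (c * f 0)) (∑-*ˡ k c (f ∘ suc))) (sym (*-distribˡ-+ c (f 0) _))

  ∑-0 : ∀ k → ∑ k (λ _ → 0ℚ) ≡ 0ℚ
  ∑-0 k = trans (∑-const k 0ℚ) (*-zeroʳ (ι (+ k)))

  ∑-swap : ∀ a b (f : ℕ → ℕ → ℚ) → ∑ a (λ i → ∑ b (f i)) ≡ ∑ b (λ j → ∑ a (λ i → f i j))
  ∑-swap zero    b f = sym (∑-0 b)
  ∑-swap (suc a) b f = trans (cong (_+_ (∑ b (f 0))) (∑-swap a b (f ∘ suc))) (sym (∑-+ b (f 0) _))

  ∑-blocks : ∀ u b f → ∑ (u ℕ.* b) f ≡ ∑ u (λ i → ∑ b (λ l → f (i ℕ.* b ℕ.+ l)))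
  ∑-blocks zero    b f = refl
  ∑-blocks (suc u) b f = trans (∑-++ b (u ℕ.* b) f) (cong (_+_ (∑ b f)) (trans (∑-blocks u b _)
    (∑-cong u (λ i → ∑-cong b (λ l → cong f (sym (ℕ.+-assoc b (i ℕ.* b) l)))))))

  ∑-toℕ : ∀ {k} {f : Fin k → ℚ} {g : ℕ → ℚ} → (∀ j → f j ≡ g (toℕ j)) → sumℚ f ≡ ∑ k g
  ∑-toℕ {zero}  f≗g = refl
  ∑-toℕ {suc k} f≗g = cong₂ _+_ (f≗g Fin.zero) (∑-toℕ (f≗g ∘ Fin.suc))

  Periodic : {A : Set} → ℕ → (ℕ → A) → Set
  Periodic d g = ∀ i → g (d ℕ.+ i) ≡ g i

  ∑-period : ∀ {d g} → Periodic d g → ∀ s → ∑ d (λ i → g (s ℕ.+ i)) ≡ ∑ d g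
  ∑-period {d} {g} per zero    = refl
  ∑-period {d} {g} per (suc s) = trans (∑-period {d} {g ∘ suc} (λ i → trans (cong g (sym (ℕ.+-suc d i))) (per (suc i))) s)
    (+-cancelˡ (g 0) (begin
      g 0 + ∑ d (g ∘ suc)                     ≡⟨⟩
      ∑ (1 ℕ.+ d) g                           ≡⟨ cong (λ k → ∑ k g) (ℕ.+-comm 1 d) ⟩
      ∑ (d ℕ.+ 1) g                           ≡⟨ ∑-++ d 1 g ⟩
      ∑ d g + (g (d ℕ.+ 0) + 0ℚ)              ≡⟨ cong (_+_ (∑ d g)) (trans (+-identityʳ _) (per 0)) ⟩
      ∑ d g + g 0                             ≡⟨ +-comm (∑ d g) (g 0) ⟩
      g 0 + ∑ d g                             ∎))
    where
    open ≡-Reasoning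
    +-cancelˡ : ∀ a {b c} → a + b ≡ a + c → b ≡ c
    +-cancelˡ a {b} {c} e = trans (solve 2 (λ a b → b := (a :+ b) :- a) refl a b)
      (trans (cong (_- a) e) (solve 2 (λ a c → (a :+ c) :- a := c) refl a c))
      where open +-*-Solver

  periodic-* : ∀ {A : Set} {d} {g : ℕ → A} → Periodic d g → ∀ k i → g (i ℕ.+ k ℕ.* d) ≡ g i
  periodic-* {g = g} per zero    i = cong g (ℕ.+-identityʳ i)
  periodic-* {d = d} {g} per (suc k) i = trans (cong g (trans (sym (ℕ.+-assoc i d (k ℕ.* d)))
    (trans (cong (ℕ._+ k ℕ.* d) (ℕ.+-comm i d)) (ℕ.+-assoc d i (k ℕ.* d))))) (trans (per _) (periodic-* {g = g} per k i))

  periodic-% : ∀ {A : Set} {d} .{{_ : NonZero d}} {g : ℕ → A} → Periodic d g → ∀ i → g (i % d) ≡ g i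
  periodic-% {d = d} {g} per i =
    trans (sym (periodic-* {g = g} per (i / d) (i % d))) (cong g (sym (m≡m%n+[m/n]*n i d)))

module CyclicWindows where

  open import Defs
  open BoxHeights
  open RationalSums
  open import Data.Bool using (T; true; false; if_then_else_)
  open import Data.Nat as ℕ using (ℕ; zero; suc; _<_; _<ᵇ_; NonZero)
  import Data.Nat.Properties as ℕ
  open import Data.Nat.DivMod using (_mod_; _%_; [m+n]%n≡m%n; [m+kn]%n≡m%n; m<n⇒m%n≡m)
  open import Data.Nat.Tactic.RingSolver using (solve-∀)
  open import Data.Integer using (+_)
  open import Data.Fin as Fin using (Fin; toℕ)
  open import Data.Fin.Properties using (toℕ-injective; toℕ-fromℕ<; toℕ<n)
  open import Data.Rational using (ℚ; 0ℚ; 1ℚ; _+_; _*_; -_; _-_; _≤_)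
  open import Data.Rational.Properties
  open import Data.Rational.Solver using (module +-*-Solver)
  open import Relation.Nullary using (contradiction)
  open import Relation.Binary.PropositionalEquality
  open import Function using (_∘_)

  lift : ∀ {A : Set} {d} .{{_ : NonZero d}} → (Fin d → A) → ℕ → A
  lift {d = d} ρ i = ρ (i mod d)

  lift-periodic : ∀ {A : Set} {d} .{{_ : NonZero d}} (ρ : Fin d → A) → Periodic d (lift ρ)
  lift-periodic {d = d} ρ i = cong ρ (toℕ-injective (begin
    toℕ ((d ℕ.+ i) mod d)  ≡⟨ toℕ-fromℕ< _ ⟩
    (d ℕ.+ i) % d          ≡⟨ cong (_% d) (ℕ.+-comm d i) ⟩
    (i ℕ.+ d) % d          ≡⟨ [m+n]%n≡m%n i d ⟩
    i % d                  ≡⟨ toℕ-fromℕ< _ ⟨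
    toℕ (i mod d)          ∎))
    where open ≡-Reasoning

  lift-toℕ : ∀ {A : Set} {d} .{{_ : NonZero d}} (ρ : Fin d → A) j → lift ρ (toℕ j) ≡ ρ j
  lift-toℕ {d = d} ρ j = cong ρ (toℕ-injective (trans (toℕ-fromℕ< _) (m<n⇒m%n≡m (toℕ<n j))))

  module Circulant (m-1 n : ℕ) where
    open Heights m-1 n using (m; d)

    window : (ℕ → ℚ) → ℕ → ℚ
    window r s = ∑ m (λ l → r (s ℕ.+ l))

    window-periodic : ∀ {r} → Periodic d r → Periodic d (window r)
    window-periodic {r} per s = ∑-cong m (λ l → trans (cong r (ℕ.+-assoc d s l)) (per (s ℕ.+ l)))

    private
      indicator : ℕ → ℚ
      indicator x = if x <ᵇ m then 1ℚ else 0ℚ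

      indicator-< : ∀ {x} → x < m → indicator x ≡ 1ℚ
      indicator-< {x} x<m with x <ᵇ m | ℕ.<⇒<ᵇ x<m
      ... | true | _ = refl

      indicator-≥ : ∀ {x} → m ℕ.≤ x → indicator x ≡ 0ℚ
      indicator-≥ {x} m≤x with x <ᵇ m in eq
      ... | false = refl
      ... | true  = contradiction (ℕ.<ᵇ⇒< x m (subst T (sym eq) _)) (ℕ.≤⇒≯ m≤x)

      -- c - j modulo d, with - j replaced by (d - 1) j to avoid truncated subtraction.
      residue : ℕ → ℕ → ℕ
      residue c j = (c ℕ.+ (m-1 ℕ.+ n) ℕ.* j) % d

      residue-periodic : ∀ c → Periodic d (residue c)
      residue-periodic c j = trans (cong (_% d) (rearrange c (m-1 ℕ.+ n) j)) ([m+kn]%n≡m%n (c ℕ.+ (m-1 ℕ.+ n) ℕ.* j) (m-1 ℕ.+ n) d)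
        where
        rearrange : ∀ c e j → c ℕ.+ e ℕ.* (suc e ℕ.+ j) ≡ c ℕ.+ e ℕ.* j ℕ.+ e ℕ.* suc e
        rearrange = solve-∀

      residue-∸ : ∀ c {j} → j ℕ.≤ d → (c ℕ.+ d ℕ.∸ j) % d ≡ residue c j
      residue-∸ c {j} j≤d = begin
        x % d                                    ≡⟨ [m+kn]%n≡m%n x j d ⟨
        (x ℕ.+ j ℕ.* d) % d                      ≡⟨ cong (_% d) (split x j (m-1 ℕ.+ n)) ⟩
        (x ℕ.+ j ℕ.+ (m-1 ℕ.+ n) ℕ.* j) % d
          ≡⟨ cong (λ y → (y ℕ.+ (m-1 ℕ.+ n) ℕ.* j) % d) (ℕ.m∸n+n≡m (ℕ.≤-trans j≤d (ℕ.m≤n+m d c))) ⟩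
        (c ℕ.+ d ℕ.+ (m-1 ℕ.+ n) ℕ.* j) % d      ≡⟨ cong (_% d) (swap c d _) ⟩
        (c ℕ.+ (m-1 ℕ.+ n) ℕ.* j ℕ.+ d) % d      ≡⟨ [m+n]%n≡m%n (c ℕ.+ (m-1 ℕ.+ n) ℕ.* j) d ⟩
        residue c j                              ∎
        where
        open ≡-Reasoning
        x = c ℕ.+ d ℕ.∸ j
        split : ∀ x j e → x ℕ.+ j ℕ.* suc e ≡ x ℕ.+ j ℕ.+ e ℕ.* j
        split = solve-∀
        swap : ∀ a b c → a ℕ.+ b ℕ.+ c ≡ a ℕ.+ c ℕ.+ b
        swap = solve-∀

      residue-beyond : ∀ c j e → j ℕ.+ e ≡ m-1 ℕ.+ n → residue c (suc c ℕ.+ j) ≡ e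
      residue-beyond c j e j+e≡ = begin
        residue c (suc c ℕ.+ j)               ≡⟨ cong (λ y → (c ℕ.+ y ℕ.* (suc c ℕ.+ j)) % d) j+e≡ ⟨
        (c ℕ.+ (j ℕ.+ e) ℕ.* (suc c ℕ.+ j)) % d  ≡⟨ cong (_% d) (rearrange c j e) ⟩
        (e ℕ.+ (c ℕ.+ j) ℕ.* suc (j ℕ.+ e)) % d
          ≡⟨ cong (λ y → (e ℕ.+ (c ℕ.+ j) ℕ.* suc y) % d) j+e≡ ⟩
        (e ℕ.+ (c ℕ.+ j) ℕ.* d) % d           ≡⟨ [m+kn]%n≡m%n e (c ℕ.+ j) d ⟩
        e % d                                 ≡⟨ m<n⇒m%n≡m (ℕ.s≤s (subst (e ℕ.≤_) j+e≡ (ℕ.m≤n+m e j))) ⟩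
        e                                     ∎
        where
        open ≡-Reasoning
        rearrange : ∀ c j e → c ℕ.+ (j ℕ.+ e) ℕ.* (suc c ℕ.+ j) ≡ e ℕ.+ (c ℕ.+ j) ℕ.* suc (j ℕ.+ e)
        rearrange = solve-∀

    -- Coordinate c of ∑ μⱼ vⱼ collects the weights of the m cyclically consecutive vertices ending at c;
    -- modulo d = m + n these start at c + 1 + n.
    vert-window : ∀ (μ : Fin (suc d) → ℚ) c →
      sumℚ (λ j → μ j * vert d m j c) ≡ window (lift (μ ∘ Fin.suc)) (toℕ c ℕ.+ suc n)
    vert-window μ c′ = begin
      sumℚ (λ j → μ j * vert d m j c′)
        ≡⟨ cong₂ _+_ (*-zeroʳ (μ Fin.zero)) (∑-toℕ {g = g} summand) ⟩
      0ℚ + ∑ d g                                             ≡⟨ +-identityˡ _ ⟩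
      ∑ d g                                                  ≡⟨ ∑-period {d} {g} g-periodic (suc c) ⟨
      ∑ d (λ j → g (suc c ℕ.+ j))                            ≡⟨ cong (λ k → ∑ k (λ j → g (suc c ℕ.+ j))) (ℕ.+-comm m n) ⟩
      ∑ (n ℕ.+ m) (λ j → g (suc c ℕ.+ j))                    ≡⟨ ∑-++ n m _ ⟩
      ∑ n (λ j → g (suc c ℕ.+ j)) + ∑ m (λ l → g (suc c ℕ.+ (n ℕ.+ l)))
        ≡⟨ cong₂ _+_ (trans (∑-cong-< n outside) (∑-0 n)) (∑-cong-< m inside) ⟩
      0ℚ + window r (c ℕ.+ suc n)                            ≡⟨ +-identityˡ _ ⟩
      window r (c ℕ.+ suc n)                                 ∎
      where
      open ≡-Reasoning
      c = toℕ c′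
      r = lift (μ ∘ Fin.suc)
      g : ℕ → ℚ
      g j = r j * indicator (residue c j)
      summand : ∀ j → μ (Fin.suc j) * indicator ((c ℕ.+ d ℕ.∸ toℕ j) % d) ≡ g (toℕ j)
      summand j = cong₂ _*_ (sym (lift-toℕ (μ ∘ Fin.suc) j))
        (cong indicator (residue-∸ c (ℕ.<⇒≤ (toℕ<n j))))
      g-periodic : Periodic d g
      g-periodic j = cong₂ _*_ (lift-periodic (μ ∘ Fin.suc) j) (cong indicator (residue-periodic c j))
      outside : ∀ j → j < n → g (suc c ℕ.+ j) ≡ 0ℚ
      outside j j<n = trans (cong (_*_ (r (suc c ℕ.+ j))) (trans
          (cong indicator (residue-beyond c j (m-1 ℕ.+ n ℕ.∸ j) (ℕ.m+[n∸m]≡n (ℕ.≤-trans (ℕ.<⇒≤ j<n) (ℕ.m≤n+m n m-1)))))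
          (indicator-≥ (ℕ.m+n≤o⇒m≤o∸n m (subst (ℕ._≤ m-1 ℕ.+ n) (ℕ.+-suc m-1 j) (ℕ.+-monoʳ-≤ m-1 j<n))))))
        (*-zeroʳ (r (suc c ℕ.+ j)))
      inside : ∀ l → l < m → g (suc c ℕ.+ (n ℕ.+ l)) ≡ r (c ℕ.+ suc n ℕ.+ l)
      inside l l<m = trans (cong₂ _*_ (cong r (shape c n l)) (trans
          (cong indicator (residue-beyond c (n ℕ.+ l) (m-1 ℕ.∸ l) (trans (ℕ.+-assoc n l _)
            (trans (cong (n ℕ.+_) (ℕ.m+[n∸m]≡n (ℕ.s≤s⁻¹ l<m))) (ℕ.+-comm n m-1)))))
          (indicator-< (ℕ.s≤s (ℕ.m∸n≤m m-1 l)))))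
        (*-identityʳ _)
        where
        shape : ∀ c n l → suc c ℕ.+ (n ℕ.+ l) ≡ c ℕ.+ suc n ℕ.+ l
        shape = solve-∀

    source : Fin d → ℕ
    source j = toℕ j ℕ.+ (m-1 ℕ.+ n) ℕ.* suc n

    module _ (u v : ℕ) (um≡1+vd : u ℕ.* m ≡ suc (v ℕ.* d)) where

      -- u consecutive windows cover the circle v times and one further position.
      inversion : ∀ (ρ : Fin d → ℚ) (V : ℕ → ℚ) → (∀ i → V i ≡ window (lift ρ) (i ℕ.+ suc n)) →
        ∀ j → ι (+ m) * ρ j ≡ ι (+ m) * ∑ u (λ i → V (source j ℕ.+ i ℕ.* m)) - ι (+ v) * ∑ d V
      inversion ρ V V≡ j = begin
        ι (+ m) * ρ j
          ≡⟨ solve 4 (λ m r v s → m :* r := m :* (r :+ v :* s) :- v :* (m :* s)) refl (ι (+ m)) (ρ j) (ι (+ v)) S ⟩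
        ι (+ m) * (ρ j + ι (+ v) * S) - ι (+ v) * (ι (+ m) * S)
          ≡⟨ cong₂ (λ a b → ι (+ m) * a - ι (+ v) * b) cover total ⟨
        ι (+ m) * ∑ u (λ i → V (source j ℕ.+ i ℕ.* m)) - ι (+ v) * ∑ d V ∎
        where
        open ≡-Reasoning
        open +-*-Solver
        r = lift ρ
        S = ∑ d r
        base = source j ℕ.+ suc n
        base≡ : ∀ x e k → x ℕ.+ e ℕ.* k ℕ.+ k ≡ x ℕ.+ k ℕ.* suc e
        base≡ = solve-∀
        shape₁ : ∀ s i n l → s ℕ.+ i ℕ.+ n ℕ.+ l ≡ s ℕ.+ n ℕ.+ (i ℕ.+ l)
        shape₁ = solve-∀
        shape₂ : ∀ b i l → b ℕ.+ suc (i ℕ.+ l) ≡ b ℕ.+ suc i ℕ.+ l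
        shape₂ = solve-∀
        shape₃ : ∀ c n l → c ℕ.+ n ℕ.+ l ≡ n ℕ.+ l ℕ.+ c
        shape₃ = solve-∀
        r-base : r (base ℕ.+ 0) ≡ ρ j
        r-base = begin
          r (base ℕ.+ 0)               ≡⟨ cong r (trans (ℕ.+-identityʳ base) (base≡ (toℕ j) (m-1 ℕ.+ n) (suc n))) ⟩
          r (toℕ j ℕ.+ suc n ℕ.* d)    ≡⟨ periodic-* {g = r} (lift-periodic ρ) (suc n) (toℕ j) ⟩
          r (toℕ j)                    ≡⟨ lift-toℕ ρ j ⟩
          ρ j                          ∎
        cover : ∑ u (λ i → V (source j ℕ.+ i ℕ.* m)) ≡ ρ j + ι (+ v) * S
        cover = begin
          ∑ u (λ i → V (source j ℕ.+ i ℕ.* m))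
            ≡⟨ ∑-cong u (λ i → trans (V≡ _) (∑-cong m (λ l → cong r (shape₁ (source j) (i ℕ.* m) (suc n) l)))) ⟩
          ∑ u (λ i → ∑ m (λ l → r (base ℕ.+ (i ℕ.* m ℕ.+ l))))
            ≡⟨ ∑-blocks u m (λ x → r (base ℕ.+ x)) ⟨
          ∑ (u ℕ.* m) (λ x → r (base ℕ.+ x))           ≡⟨ cong (λ k → ∑ k (λ x → r (base ℕ.+ x))) um≡1+vd ⟩
          r (base ℕ.+ 0) + ∑ (v ℕ.* d) (λ x → r (base ℕ.+ suc x))
            ≡⟨ cong₂ _+_ r-base (∑-blocks v d (λ x → r (base ℕ.+ suc x))) ⟩
          ρ j + ∑ v (λ i → ∑ d (λ l → r (base ℕ.+ suc (i ℕ.* d ℕ.+ l))))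
            ≡⟨ cong (_+_ (ρ j)) (∑-cong v (λ i → trans (∑-cong d (λ l → cong r (shape₂ base (i ℕ.* d) l)))
                 (∑-period {d} {r} (lift-periodic ρ) (base ℕ.+ suc (i ℕ.* d))))) ⟩
          ρ j + ∑ v (λ _ → S)                          ≡⟨ cong (_+_ (ρ j)) (∑-const v S) ⟩
          ρ j + ι (+ v) * S                            ∎
        total : ∑ d V ≡ ι (+ m) * S
        total = begin
          ∑ d V                                                  ≡⟨ ∑-cong d V≡ ⟩
          ∑ d (λ c → ∑ m (λ l → r (c ℕ.+ suc n ℕ.+ l)))          ≡⟨ ∑-swap d m (λ c l → r (c ℕ.+ suc n ℕ.+ l)) ⟩
          ∑ m (λ l → ∑ d (λ c → r (c ℕ.+ suc n ℕ.+ l)))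
            ≡⟨ ∑-cong m (λ l → trans (∑-cong d (λ c → cong r (shape₃ c (suc n) l)))
                 (∑-period {d} {r} (lift-periodic ρ) (suc n ℕ.+ l))) ⟩
          ∑ m (λ _ → S)                                          ≡⟨ ∑-const m S ⟩
          ι (+ m) * S                                            ∎

module Dilates where

  open import Defs
  open BoxHeights
  open RationalSums
  open CyclicWindows
  open import Data.Nat as ℕ using (ℕ; zero; suc; _<_; NonZero)
  import Data.Nat.Properties as ℕ
  open import Data.Nat.DivMod using (_mod_; _%_; m%n<n; [m+kn]%n≡m%n; m<n⇒m%n≡m)
  open import Data.Nat.Tactic.RingSolver using (solve-∀)
  open import Data.Integer as ℤ using (ℤ; +_; -[1+_]; ∣_∣; _/ℕ_; _%ℕ_)
  import Data.Integer.Properties as ℤ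
  open import Data.Integer.DivMod using (n%ℕd<d; a≡a%ℕn+[a/ℕn]*n)
  import Data.Integer.Solver as ℤ-Solver
  open import Data.Fin as Fin using (Fin; toℕ)
  open import Data.Fin.Properties using (toℕ-fromℕ<)
  open import Data.Rational using (ℚ; 0ℚ; 1ℚ; _+_; _*_; -_; _-_; _≤_)
  import Data.Rational as ℚ
  open import Data.Rational.Properties
  open import Data.Rational.Solver using (module +-*-Solver)
  open import Data.Vec using (Vec; []; _∷_; lookup; tabulate; sum)
  open import Data.Vec.Properties using (lookup∘tabulate; tabulate∘lookup; tabulate-cong)
  open import Data.Product using (_×_; _,_; ∃-syntax)
  open import Relation.Nullary using (contradiction)
  open import Relation.Binary.PropositionalEquality
  open import Function using (_∘_)

  sumℚ-cong : ∀ {k} {f g : Fin k → ℚ} → f ≗ g → sumℚ f ≡ sumℚ g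
  sumℚ-cong {zero}  f≗g = refl
  sumℚ-cong {suc k} f≗g = cong₂ _+_ (f≗g Fin.zero) (sumℚ-cong (f≗g ∘ Fin.suc))

  sumℚ-*ˡ : ∀ {k} c (f : Fin k → ℚ) → sumℚ (λ j → c * f j) ≡ c * sumℚ f
  sumℚ-*ˡ {zero}  c f = sym (*-zeroʳ c)
  sumℚ-*ˡ {suc k} c f = trans (cong (_+_ (c * f Fin.zero)) (sumℚ-*ˡ c (f ∘ Fin.suc)))
    (sym (*-distribˡ-+ c (f Fin.zero) _))

  lookup-ext : ∀ {A : Set} {k} {x y : Vec A k} → lookup x ≗ lookup y → x ≡ y
  lookup-ext {x = x} {y} e = trans (sym (tabulate∘lookup x)) (trans (tabulate-cong e) (tabulate∘lookup y))

  0≤* : ∀ {p q} → 0ℚ ≤ p → 0ℚ ≤ q → 0ℚ ≤ p * q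
  0≤* {p} {q} 0≤p 0≤q =
    nonNegative⁻¹ (p * q) {{nonNeg*nonNeg⇒nonNeg p {{ℚ.nonNegative 0≤p}} q {{ℚ.nonNegative 0≤q}}}}

  0≤ι : ∀ k → 0ℚ ≤ ι (+ k)
  0≤ι k = nonNegative⁻¹ (ι (+ k)) {{ι-nonNeg k}}

  0≤inv : ∀ k .{{_ : NonZero k}} → 0ℚ ≤ inv k
  0≤inv k = nonNegative⁻¹ (inv k) {{inv-nonNeg k}}

  module LatticePoints (m-1 n : ℕ) where
    open Heights m-1 n
    open Circulant m-1 n

    Represents : Vec ℤ d → (Fin d → ℚ) → Set
    Represents x ρ = ∀ c → ι (lookup x c) ≡ window (lift ρ) (toℕ c ℕ.+ suc n)

    inDilate⁺ : ∀ {k} .{{_ : NonZero k}} x ρ →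
      (∀ j → 0ℚ ≤ ρ j) → sumℚ ρ ≤ ι (+ k) → Represents x ρ → InDilate d m k x
    inDilate⁺ {k} x ρ 0≤ρ ∑ρ≤k x≡ = μ , 0≤μ , ∑μ≡1 , x≡′
      where
      μ : Fin (suc d) → ℚ
      μ Fin.zero    = 1ℚ - sumℚ (λ j → inv k * ρ j)
      μ (Fin.suc j) = inv k * ρ j
      ∑≤1 : sumℚ (λ j → inv k * ρ j) ≤ 1ℚ
      ∑≤1 = begin
        sumℚ (λ j → inv k * ρ j)   ≡⟨ sumℚ-*ˡ (inv k) ρ ⟩
        inv k * sumℚ ρ             ≤⟨ *-monoˡ-≤-nonNeg (inv k) {{inv-nonNeg k}} ∑ρ≤k ⟩
        inv k * ι (+ k)            ≡⟨ *-comm (inv k) (ι (+ k)) ⟩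
        ι (+ k) * inv k            ≡⟨ ι*inv k ⟩
        1ℚ                         ∎
        where open ≤-Reasoning
      0≤μ : ∀ j → 0ℚ ≤ μ j
      0≤μ Fin.zero    = subst (_≤ μ Fin.zero) (+-inverseʳ s) (+-monoˡ-≤ (- s) ∑≤1)
        where s = sumℚ (λ j → inv k * ρ j)
      0≤μ (Fin.suc j) = 0≤* (0≤inv k) (0≤ρ j)
      ∑μ≡1 : sumℚ μ ≡ 1ℚ
      ∑μ≡1 = solve 2 (λ o s → (o :- s) :+ s := o) refl 1ℚ (sumℚ (λ j → inv k * ρ j))
        where open +-*-Solver
      x≡′ : ∀ c → ι (lookup x c) ≡ ι (+ k) * sumℚ (λ j → μ j * vert d m j c)
      x≡′ c = begin
        ι (lookup x c)                                              ≡⟨ x≡ c ⟩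
        window (lift ρ) s
          ≡⟨ ∑-cong m (λ l → rescale (lift ρ (s ℕ.+ l))) ⟩
        ∑ m (λ l → ι (+ k) * (inv k * lift ρ (s ℕ.+ l)))            ≡⟨ ∑-*ˡ m (ι (+ k)) (λ l → inv k * lift ρ (s ℕ.+ l)) ⟩
        ι (+ k) * window (lift (μ ∘ Fin.suc)) s                     ≡⟨ cong (_*_ (ι (+ k))) (vert-window μ c) ⟨
        ι (+ k) * sumℚ (λ j → μ j * vert d m j c)                   ∎
        where
        open ≡-Reasoning
        s = toℕ c ℕ.+ suc n
        rescale : ∀ p → p ≡ ι (+ k) * (inv k * p)
        rescale p = sym (trans (sym (*-assoc (ι (+ k)) (inv k) p)) (trans (cong (_* p) (ι*inv k)) (*-identityˡ p)))

    inDilate⁻ : ∀ {k} x → InDilate d m k x →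
      ∃[ ρ ] (∀ j → 0ℚ ≤ ρ j) × sumℚ ρ ≤ ι (+ k) × Represents x ρ
    inDilate⁻ {k} x (μ , 0≤μ , ∑μ≡1 , x≡) = ρ , (λ j → 0≤* (0≤ι k) (0≤μ (Fin.suc j))) , ∑ρ≤k , represents
      where
      ρ : Fin d → ℚ
      ρ j = ι (+ k) * μ (Fin.suc j)
      ∑ρ≤k : sumℚ ρ ≤ ι (+ k)
      ∑ρ≤k = begin
        sumℚ ρ                                     ≡⟨ sumℚ-*ˡ (ι (+ k)) (μ ∘ Fin.suc) ⟩
        ι (+ k) * sumℚ (μ ∘ Fin.suc)
          ≤⟨ *-monoˡ-≤-nonNeg (ι (+ k)) {{ι-nonNeg k}} (p≤q+p (μ Fin.zero) (0≤μ Fin.zero)) ⟩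
        ι (+ k) * sumℚ μ                           ≡⟨ cong (_*_ (ι (+ k))) ∑μ≡1 ⟩
        ι (+ k) * 1ℚ                               ≡⟨ *-identityʳ _ ⟩
        ι (+ k)                                    ∎
        where
        open ≤-Reasoning
        p≤q+p : ∀ q {p} → 0ℚ ≤ q → p ≤ q + p
        p≤q+p q {p} 0≤q = subst (_≤ q + p) (+-identityˡ p) (+-monoˡ-≤ p 0≤q)
      represents : Represents x ρ
      represents c = trans (x≡ c) (trans (cong (_*_ (ι (+ k))) (vert-window μ c))
        (sym (∑-*ˡ m (ι (+ k)) (λ l → lift (μ ∘ Fin.suc) (toℕ c ℕ.+ suc n ℕ.+ l)))))

    represents-lift : ∀ {x ρ} → Represents x ρ →
      ∀ i → ι (lift (lookup x) i) ≡ window (lift ρ) (i ℕ.+ suc n)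
    represents-lift {x} {ρ} x≡ i = begin
      ι (lookup x (i mod d))                        ≡⟨ x≡ (i mod d) ⟩
      window (lift ρ) (toℕ (i mod d) ℕ.+ suc n)     ≡⟨ cong (λ j → window (lift ρ) (j ℕ.+ suc n)) (toℕ-fromℕ< (m%n<n i d)) ⟩
      window (lift ρ) (i % d ℕ.+ suc n)             ≡⟨ periodic-% {d = d} {g} g-periodic i ⟩
      window (lift ρ) (i ℕ.+ suc n)                 ∎
      where
      open ≡-Reasoning
      g : ℕ → ℚ
      g i = window (lift ρ) (i ℕ.+ suc n)
      g-periodic : Periodic d g
      g-periodic i = trans (cong (window (lift ρ)) (ℕ.+-assoc d i (suc n)))
        (window-periodic (lift-periodic ρ) (i ℕ.+ suc n))

    weight : ∀ {k} → ℕ → Vec ℕ k → Fin k → ℚ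
    weight t a j = ι (+ lookup a j) + ι (+ t) * inv m

    0≤weight : ∀ {k} t (a : Vec ℕ k) j → 0ℚ ≤ weight t a j
    0≤weight t a j = +-mono-≤ (0≤ι (lookup a j)) (0≤* (0≤ι t) (0≤inv m))

    m*τ : ∀ t → ι (+ m) * (ι (+ t) * inv m) ≡ ι (+ t)
    m*τ t = trans (solve 3 (λ m t i → m :* (t :* i) := (m :* i) :* t) refl (ι (+ m)) (ι (+ t)) (inv m))
      (trans (cong (_* ι (+ t)) (ι*inv m)) (*-identityˡ _))
      where open +-*-Solver

    m*[_+τ] : ∀ b t → ι (+ m) * (ι b + ι (+ t) * inv m) ≡ ι (+ t ℤ.+ b ℤ.* + m)
    m*[ b +τ] t = begin
      ι (+ m) * (ι b + ι (+ t) * inv m)             ≡⟨ *-distribˡ-+ (ι (+ m)) (ι b) _ ⟩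
      ι (+ m) * ι b + ι (+ m) * (ι (+ t) * inv m)   ≡⟨ cong₂ _+_ (*-comm (ι (+ m)) (ι b)) (m*τ t) ⟩
      ι b * ι (+ m) + ι (+ t)                       ≡⟨ +-comm _ (ι (+ t)) ⟩
      ι (+ t) + ι b * ι (+ m)                       ≡⟨ cong (_+_ (ι (+ t))) (ι-* b (+ m)) ⟨
      ι (+ t) + ι (b ℤ.* + m)                       ≡⟨ ι-+ (+ t) (b ℤ.* + m) ⟨
      ι (+ t ℤ.+ b ℤ.* + m)                         ∎
      where open ≡-Reasoning

    m*weight : ∀ {k} t (a : Vec ℕ k) j → ι (+ m) * weight t a j ≡ ι (+ (t ℕ.+ lookup a j ℕ.* m))
    m*weight t a j = trans (m*[ + lookup a j +τ] t)
      (cong ι (trans (cong (ℤ._+_ (+ t)) (sym (ℤ.pos-* (lookup a j) m))) (sym (ℤ.pos-+ t _))))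

    m*∑weight : ∀ {k} t (a : Vec ℕ k) → ι (+ m) * sumℚ (weight t a) ≡ ι (+ (sum a ℕ.* m ℕ.+ t ℕ.* k))
    m*∑weight t []      = trans (*-zeroʳ (ι (+ m))) (cong (ι ∘ +_) (sym (ℕ.*-zeroʳ t)))
    m*∑weight {suc k} t (x ∷ a) = begin
      ι (+ m) * (weight t (x ∷ a) Fin.zero + sumℚ (weight t a))
        ≡⟨ *-distribˡ-+ (ι (+ m)) (weight t (x ∷ a) Fin.zero) _ ⟩
      ι (+ m) * weight t (x ∷ a) Fin.zero + ι (+ m) * sumℚ (weight t a)
        ≡⟨ cong₂ _+_ (m*weight t (x ∷ a) Fin.zero) (m*∑weight t a) ⟩
      ι (+ (t ℕ.+ x ℕ.* m)) + ι (+ (sum a ℕ.* m ℕ.+ t ℕ.* k))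
        ≡⟨ ι-+ (+ (t ℕ.+ x ℕ.* m)) (+ (sum a ℕ.* m ℕ.+ t ℕ.* k)) ⟨
      ι (+ (t ℕ.+ x ℕ.* m ℕ.+ (sum a ℕ.* m ℕ.+ t ℕ.* k)))
        ≡⟨ cong (ι ∘ +_) (rearrange t x m (sum a) k) ⟩
      ι (+ (sum (x ∷ a) ℕ.* m ℕ.+ t ℕ.* suc k)) ∎
      where
      open ≡-Reasoning
      rearrange : ∀ t x m s k → t ℕ.+ x ℕ.* m ℕ.+ (s ℕ.* m ℕ.+ t ℕ.* k) ≡ (x ℕ.+ s) ℕ.* m ℕ.+ t ℕ.* suc k
      rearrange = solve-∀

    ∑weight-≤⁺ : ∀ {k} t (a : Vec ℕ d) → height t ℕ.+ sum a ℕ.≤ k → sumℚ (weight t a) ≤ ι (+ k)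
    ∑weight-≤⁺ {k} t a le = ι*-cancel-≤ m (begin
      ι (+ m) * sumℚ (weight t a)            ≡⟨ m*∑weight t a ⟩
      ι (+ (sum a ℕ.* m ℕ.+ t ℕ.* d))        ≤⟨ ι-mono-≤ (ℤ.+≤+ (height+-≤⁻ t (sum a) k le)) ⟩
      ι (+ (k ℕ.* m))                        ≡⟨ cong (ι ∘ +_) (ℕ.*-comm k m) ⟩
      ι (+ (m ℕ.* k))                        ≡⟨ cong ι (ℤ.pos-* m k) ⟩
      ι (+ m ℤ.* + k)                        ≡⟨ ι-* (+ m) (+ k) ⟩
      ι (+ m) * ι (+ k)                      ∎)
      where open ≤-Reasoning

    ∑weight-≤⁻ : ∀ {k} t (a : Vec ℕ d) → sumℚ (weight t a) ≤ ι (+ k) → height t ℕ.+ sum a ℕ.≤ k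
    ∑weight-≤⁻ {k} t a le = height+-≤⁺ t (sum a) k (ℤ.drop‿+≤+ (ι-cancel-≤ (begin
      ι (+ (sum a ℕ.* m ℕ.+ t ℕ.* d))        ≡⟨ m*∑weight t a ⟨
      ι (+ m) * sumℚ (weight t a)            ≤⟨ *-monoˡ-≤-nonNeg (ι (+ m)) {{ι-nonNeg m}} le ⟩
      ι (+ m) * ι (+ k)                      ≡⟨ ι-* (+ m) (+ k) ⟨
      ι (+ m ℤ.* + k)                        ≡⟨ cong ι (ℤ.pos-* m k) ⟨
      ι (+ (m ℕ.* k))                        ≡⟨ cong (ι ∘ +_) (ℕ.*-comm m k) ⟩
      ι (+ (k ℕ.* m))                        ∎)))
      where open ≤-Reasoning

    -- (t , … , t) + ∑ aⱼ vⱼ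
    point : ℕ × Vec ℕ d → Vec ℤ d
    point (t , a) = tabulate λ c → ∑ℤ m (λ l → + lift (lookup a) (toℕ c ℕ.+ suc n ℕ.+ l)) ℤ.+ + t

    point-represents : ∀ t a → Represents (point (t , a)) (weight t a)
    point-represents t a c = begin
      ι (lookup (point (t , a)) c)        ≡⟨ cong ι (lookup∘tabulate coordinate c) ⟩
      ι (∑ℤ m α ℤ.+ + t)                  ≡⟨ ι-+ (∑ℤ m α) (+ t) ⟩
      ι (∑ℤ m α) + ι (+ t)                ≡⟨ cong₂ _+_ (ι-∑ℤ m α) (sym (trans (∑-const m _) (m*τ t))) ⟩
      ∑ m (ι ∘ α) + ∑ m (λ _ → ι (+ t) * inv m)
        ≡⟨ ∑-+ m (ι ∘ α) (λ _ → ι (+ t) * inv m) ⟨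
      window (lift (weight t a)) (toℕ c ℕ.+ suc n) ∎
      where
      open ≡-Reasoning
      coordinate : Fin d → ℤ
      coordinate c = ∑ℤ m (λ l → + lift (lookup a) (toℕ c ℕ.+ suc n ℕ.+ l)) ℤ.+ + t
      α : ℕ → ℤ
      α l = + lift (lookup a) (toℕ c ℕ.+ suc n ℕ.+ l)

    point-sound : ∀ {k} .{{_ : NonZero k}} t a → height t ℕ.+ sum a ℕ.≤ k → InDilate d m k (point (t , a))
    point-sound t a le = inDilate⁺ (point (t , a)) (weight t a) (0≤weight t a) (∑weight-≤⁺ t a le) (point-represents t a)

    module _ (u v : ℕ) (um≡1+vd : u ℕ.* m ≡ suc (v ℕ.* d)) where

      represents-unique : ∀ x {ρ σ} → Represents x ρ → Represents x σ → ρ ≗ σ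
      represents-unique x {ρ} {σ} xρ xσ j = ι*-cancel-≡ m (trans
        (inversion u v um≡1+vd ρ (ι ∘ lift (lookup x)) (represents-lift {x} {ρ} xρ) j)
        (sym (inversion u v um≡1+vd σ (ι ∘ lift (lookup x)) (represents-lift {x} {σ} xσ) j)))

      point-injective : ∀ {t a t′ a′} → t < m → t′ < m →
        point (t , a) ≡ point (t′ , a′) → (t , a) ≡ (t′ , a′)
      point-injective {t} {a} {t′} {a′} t<m t′<m e = cong₂ _,_ t≡t′ (lookup-ext a≡a′)
        where
        same : ∀ j → t ℕ.+ lookup a j ℕ.* m ≡ t′ ℕ.+ lookup a′ j ℕ.* m
        same j = ℤ.+-injective (ι-injective (trans (sym (m*weight t a j)) (trans
          (cong (_*_ (ι (+ m))) (represents-unique (point (t , a)) {weight t a} {weight t′ a′} (point-represents t a)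
            (subst (λ x → Represents x (weight t′ a′)) (sym e) (point-represents t′ a′)) j))
          (m*weight t′ a′ j))))
        t≡t′ : t ≡ t′
        t≡t′ = begin
          t                                       ≡⟨ m<n⇒m%n≡m t<m ⟨
          t % m                                   ≡⟨ [m+kn]%n≡m%n t (lookup a Fin.zero) m ⟨
          (t ℕ.+ lookup a Fin.zero ℕ.* m) % m     ≡⟨ cong (_% m) (same Fin.zero) ⟩
          (t′ ℕ.+ lookup a′ Fin.zero ℕ.* m) % m   ≡⟨ [m+kn]%n≡m%n t′ (lookup a′ Fin.zero) m ⟩
          t′ % m                                  ≡⟨ m<n⇒m%n≡m t′<m ⟩
          t′                                      ∎
          where open ≡-Reasoning
        a≡a′ : lookup a ≗ lookup a′
        a≡a′ j = ℕ.*-cancelʳ-≡ _ _ m (ℕ.+-cancelˡ-≡ t _ _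
          (trans (same j) (cong (ℕ._+ lookup a′ j ℕ.* m) (sym t≡t′))))

      represents⇒weight : ∀ {x ρ} → (∀ j → 0ℚ ≤ ρ j) → Represents x ρ →
        ∃[ t ] ∃[ a ] t < m × ρ ≗ weight t a
      represents⇒weight {x} {ρ} 0≤ρ x≡ = t , tabulate (∣_∣ ∘ b) , n%ℕd<d T m , ρ≡weight
        where
        X : ℕ → ℤ
        X = lift (lookup x)
        T : ℤ
        T = ℤ.- (+ v ℤ.* ∑ℤ d X)
        t = T %ℕ m
        q : Fin d → ℤ
        q j = ∑ℤ u (λ i → X (source j ℕ.+ i ℕ.* m))
        b : Fin d → ℤ
        b j = q j ℤ.+ T /ℕ m
        mq+T≡t+bm : ∀ j → + m ℤ.* q j ℤ.+ T ≡ + t ℤ.+ b j ℤ.* + m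
        mq+T≡t+bm j = trans (cong (ℤ._+_ (+ m ℤ.* q j)) (a≡a%ℕn+[a/ℕn]*n T m))
          (solve 4 (λ m q t e → m :* q :+ (t :+ e :* m) := t :+ (q :+ e) :* m) refl (+ m) (q j) (+ t) (T /ℕ m))
          where open ℤ-Solver.+-*-Solver
        mρ : ∀ j → ι (+ m) * ρ j ≡ ι (+ t ℤ.+ b j ℤ.* + m)
        mρ j = begin
          ι (+ m) * ρ j
            ≡⟨ inversion u v um≡1+vd ρ (ι ∘ X) (represents-lift {x} {ρ} x≡) j ⟩
          ι (+ m) * ∑ u (λ i → ι (X (source j ℕ.+ i ℕ.* m))) - ι (+ v) * ∑ d (ι ∘ X)
            ≡⟨ cong₂ (λ y z → ι (+ m) * y - ι (+ v) * z) (ι-∑ℤ u _) (ι-∑ℤ d X) ⟨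
          ι (+ m) * ι (q j) - ι (+ v) * ι (∑ℤ d X)
            ≡⟨ cong₂ (λ y z → y - z) (ι-* (+ m) (q j)) (ι-* (+ v) (∑ℤ d X)) ⟨
          ι (+ m ℤ.* q j) - ι (+ v ℤ.* ∑ℤ d X)
            ≡⟨ cong (_+_ (ι (+ m ℤ.* q j))) (ι-neg (+ v ℤ.* ∑ℤ d X)) ⟨
          ι (+ m ℤ.* q j) + ι T                  ≡⟨ ι-+ (+ m ℤ.* q j) T ⟨
          ι (+ m ℤ.* q j ℤ.+ T)                  ≡⟨ cong ι (mq+T≡t+bm j) ⟩
          ι (+ t ℤ.+ b j ℤ.* + m)                ∎
          where open ≡-Reasoning
        0≤b : ∀ z → + 0 ℤ.≤ + t ℤ.+ z ℤ.* + m → + ∣ z ∣ ≡ z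
        0≤b (+ z)    _  = refl
        0≤b -[1+ z ] le = contradiction le (ℤ.<⇒≱ (begin-strict
          + t ℤ.+ -[1+ z ] ℤ.* + m      ≤⟨ ℤ.+-monoʳ-≤ (+ t) (ℤ.*-monoʳ-≤-nonNeg (+ m) (ℤ.-≤- {z} ℕ.z≤n)) ⟩
          + t ℤ.+ ℤ.-1ℤ ℤ.* + m         ≡⟨ cong (ℤ._+_ (+ t)) (ℤ.-1*i≡-i (+ m)) ⟩
          + t ℤ.- + m                   <⟨ ℤ.+-monoˡ-< (ℤ.- + m) (ℤ.+<+ (n%ℕd<d T m)) ⟩
          + m ℤ.- + m                   ≡⟨ ℤ.+-inverseʳ (+ m) ⟩
          + 0                           ∎))
          where open ℤ.≤-Reasoning
        ρ≡weight : ∀ j → ρ j ≡ weight t (tabulate (∣_∣ ∘ b)) j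
        ρ≡weight j = ι*-cancel-≡ m (begin
          ι (+ m) * ρ j                               ≡⟨ mρ j ⟩
          ι (+ t ℤ.+ b j ℤ.* + m)                     ≡⟨ m*[ b j +τ] t ⟨
          ι (+ m) * (ι (b j) + ι (+ t) * inv m)
            ≡⟨ cong (λ z → ι (+ m) * (ι z + ι (+ t) * inv m))
                 (trans (cong +_ (lookup∘tabulate (∣_∣ ∘ b) j)) (0≤b (b j) (ι-cancel-≤
                   (subst (0ℚ ≤_) (mρ j) (0≤* (0≤ι m) (0≤ρ j)))))) ⟨
          ι (+ m) * weight t (tabulate (∣_∣ ∘ b)) j   ∎)
          where open ≡-Reasoning

      point-complete : ∀ {k} x → InDilate d m k x →
        ∃[ t ] ∃[ a ] t < m × height t ℕ.+ sum a ℕ.≤ k × point (t , a) ≡ x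
      point-complete {k} x x∈ = let
          (ρ , 0≤ρ , ∑ρ≤k , x≡) = inDilate⁻ {k} x x∈
          (t , a , t<m , ρ≡) = represents⇒weight {x} {ρ} 0≤ρ x≡
        in t , a , t<m , ∑weight-≤⁻ t a (subst (_≤ ι (+ k)) (sumℚ-cong ρ≡) ∑ρ≤k) ,
           lookup-ext (λ c → ι-injective (trans (point-represents t a c)
             (sym (trans (x≡ c) (∑-cong m (λ l → ρ≡ ((toℕ c ℕ.+ suc n ℕ.+ l) mod d)))))))

open import Defs
open import Data.Nat using (ℕ; zero; suc; _+_; _*_; _∸_; _%_; _/_; _≤_; _<_; z≤n; s≤s; _≤?_; NonZero)
open import Data.Nat.Properties
open import Data.Nat.Coprimality as Coprimality using (Coprime; coprime-Bézout; coprime-+; gcd≡1⇒coprime)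
open import Data.Nat.DivMod using (m<n⇒m/n≡0; m/n≤m)
open import Data.Nat.GCD using (gcd; module Bézout)
open import Data.Nat.Tactic.RingSolver using (solve-∀)
open import Data.Integer using (+_; 0ℤ; 1ℤ)
open import Data.List using (length; map)
open import Data.List.Membership.Propositional using (_∈_)
open import Data.List.Properties using (length-map; ++-identityʳ)
open import Data.Product using (_×_; _,_; ∃-syntax; proj₁; proj₂)
open import Data.Vec using (Vec; _∷_; sum)
open import Function.Bundles using (_⇔_; mk⇔)
open import Relation.Nullary using (Dec; yes; no; ¬_; contradiction; _×-dec_)
open import Relation.Binary.PropositionalEquality using (_≡_; refl; sym; trans; cong; _≗_; module ≡-Reasoning)
open Differences using (delta-∇^; ∇^-cong)
open BoxHeights using (fibre; fibre-empty; fibre-singleton; module Heights)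
open Enumeration
open Dilates using (module LatticePoints)

coprime⇒inverse : ∀ m-1 e → Coprime (suc m-1) (suc e) → ∃[ u ] ∃[ v ] u * suc m-1 ≡ suc (v * suc e)
coprime⇒inverse m-1 e cop with coprime-Bézout cop
... | Bézout.+- x y eq = x , y , sym eq
... | Bézout.-+ x y eq = e * x + suc e , e * y + m-1 , (begin
  (e * x + suc e) * suc m-1                     ≡⟨ expand e x m-1 ⟩
  e * suc (x * suc m-1) + suc (m-1 * suc e)     ≡⟨ cong (λ z → e * z + suc (m-1 * suc e)) eq ⟩
  e * (y * suc e) + suc (m-1 * suc e)           ≡⟨ collect e y m-1 ⟩
  suc ((e * y + m-1) * suc e)                   ∎)
  where
  open ≡-Reasoning
  expand : ∀ e x k → (e * x + suc e) * suc k ≡ e * suc (x * suc k) + suc (k * suc e)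
  expand = solve-∀
  collect : ∀ e y k → e * (y * suc e) + suc (k * suc e) ≡ suc ((e * y + k) * suc e)
  collect = solve-∀

length-tuples-0 : ∀ d → length (tuples d 0) ≡ 1
length-tuples-0 zero    = refl
length-tuples-0 (suc d) = trans (length-map (0 ∷_) (tuples d 0)) (length-tuples-0 d)

module DeltaVector (m-1 n : ℕ) (gcd≡1 : gcd (suc m-1) n ≡ 1)
  (E : ℕ → ℕ) (ehrhart : IsEhrhart (suc m-1 + n) (suc m-1) E) where

  open Heights m-1 n
  open LatticePoints m-1 n

  coprime : Coprime d m
  coprime = coprime-+ (Coprimality.sym (gcd≡1⇒coprime gcd≡1))

  length-boxed-0 : ∀ b → length (boxed {d} height (suc b) 0) ≡ 1
  length-boxed-0 zero    rewrite m<n⇒m/n≡0 (n<1+n m-1) =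
    trans (cong length (++-identityʳ (map at-0 (tuples d 0))))
      (trans (length-map at-0 (tuples d 0)) (length-tuples-0 d))
    where
    at-0 : Vec ℕ d → ℕ × Vec ℕ d
    at-0 a = 0 , a
  length-boxed-0 (suc b) with height (suc b) | height-< (n<1+n b)
  ... | suc _ | _ = length-boxed-0 b

  ehr₀≡length : ehr₀ E ≗ λ k → + length (boxed {d} height m k)
  ehr₀≡length zero    = cong +_ (sym (length-boxed-0 m-1))
  ehr₀≡length (suc k) = cong +_ (HasCard-length (boxed height m (suc k)) point
    (boxed-unique height m (suc k))
    (λ p∈ q∈ → point-injective u v um≡1+vd (proj₁ (sound p∈)) (proj₁ (sound q∈)))
    (λ {p} p∈ → point-sound {suc k} (proj₁ p) (proj₂ p) (proj₂ (sound p∈)))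
    (λ x x∈ → let (t , a , t<m , le , eq) = point-complete u v um≡1+vd x x∈ in
      (t , a) , ∈-boxed⁺ height t<m le , eq)
    (ehrhart (suc k) (s≤s z≤n)))
    where
    sound : ∀ {t a} → (t , a) ∈ boxed height m (suc k) → t < m × height t + sum a ≤ suc k
    sound = ∈-boxed⁻ height {b = m}
    inverse = coprime⇒inverse m-1 (m-1 + n) (Coprimality.sym coprime)
    u = proj₁ inverse
    v = proj₁ (proj₂ inverse)
    um≡1+vd = proj₂ (proj₂ inverse)

  delta≡fibre : ∀ i → delta d E i ≡ fibre height m i
  delta≡fibre i = trans (delta-∇^ d E i) (trans (∇^-cong (suc d) ehr₀≡length i) (∇^-boxed {d} height m i))

  good? : ∀ i → Dec (Good i)
  good? i = (1 ≤? (i * m) % d) ×-dec ((i * m) % d ≤? m-1)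

  good⇒delta≡1 : ∀ {i} → i ≤ d → Good i → delta d E i ≡ 1ℤ
  good⇒delta≡1 i≤d good with good⇒height i≤d good
  ... | t , t<m , refl = trans (delta≡fibre _) (fibre-singleton height height-injective m t<m)

  ¬good⇒delta≡0 : ∀ {i} → 1 ≤ i → i ≤ d → ¬ Good i → delta d E i ≡ 0ℤ
  ¬good⇒delta≡0 1≤i i≤d ¬good = trans (delta≡fibre _)
    (fibre-empty height m (λ t t<m eq → ¬good (height⇒good coprime 1≤i i≤d t<m eq)))

  delta≡1⇒good : ∀ {i} → 1 ≤ i → i ≤ d → delta d E i ≡ 1ℤ → Good i
  delta≡1⇒good {i} 1≤i i≤d δ≡1 with good? i
  ... | yes good = good
  ... | no ¬good = contradiction (trans (sym (¬good⇒delta≡0 1≤i i≤d ¬good)) δ≡1) λ ()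

  delta-symmetric : ∀ {i j} → 1 ≤ i → 1 ≤ j → i ≤ d → j ≤ d → i + j ≡ suc d →
    delta d E i ≡ delta d E j
  delta-symmetric {i} {j} 1≤i 1≤j i≤d j≤d i+j≡1+d with good? i
  ... | yes good = trans (good⇒delta≡1 i≤d good)
    (sym (good⇒delta≡1 j≤d (good-symmetric i+j≡1+d i≤d good)))
  ... | no ¬good = trans (¬good⇒delta≡0 1≤i i≤d ¬good) (sym (¬good⇒delta≡0 1≤j j≤d
    (λ good → ¬good (good-symmetric (trans (+-comm j i) i+j≡1+d) j≤d good))))

theorem3p2 : (m n : ℕ) → 1 ≤ m → 1 ≤ n → gcd m n ≡ 1 →
    .{{_ : NonZero (m + n)}} →
    (E : ℕ → ℕ) → IsEhrhart (m + n) m E →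
    ((i : ℕ) → 1 ≤ i → i ≤ m + n →
    ((1 ≤ (i * m) % (m + n) × (i * m) % (m + n) ≤ m ∸ 1) ⇔ (delta (m + n) E i ≡ + 1)))
    × ((i : ℕ) → i ≤ (m + n ∸ 1) / 2 →
    delta (m + n) E (1 + i) ≡ delta (m + n) E (m + n ∸ i))
theorem3p2 (suc m-1) n _ _ gcd≡1 E ehrhart =
  (λ i 1≤i i≤d → mk⇔ (good⇒delta≡1 i≤d) (delta≡1⇒good 1≤i i≤d)) ,
  (λ i i≤ → let i<d = s≤s (≤-trans i≤ (m/n≤m (m-1 + n) 2)) in
    delta-symmetric (s≤s z≤n) (m<n⇒0<n∸m i<d) i<d (m∸n≤m (suc (m-1 + n)) i)
      (cong suc (m+[n∸m]≡n (<⇒≤ i<d))))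
  where open DeltaVector m-1 n gcd≡1 E ehrhart
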